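{- Let $G$ be a biconnected graph. If all 2.5-connected components of $G$ satisfy Hajós' conjecture, then $G$ satisfies Hajós' conjecture. In particular, every graph satisfies Hajós' conjecture if and only if every 2.5-connected graph satisfies Hajós' conjecture.
   Context: Graphs are finite, may have parallel edges (a pair of parallel edges forms a cycle of length 2), and have no loops. For a graph $H$, $m(H)$ is the minimum number of edges whose removal from $H$ yields a simple graph. A graph $H$ is Eulerian if every vertex has even degree; for such $H$, $c(H)$ is the minimum number of cycles in a decomposition of $E(H)$ into edge-disjoint cycles. A graph $H$ satisfies Hajós' conjecture if, whenever $H$ is Eulerian, $c(H)\le \frac12(|V(H)|+m(H)-1)$. A graph is biconnected if it is connected and for every triple of distinct vertices $u,v,w$ there is a $u$-$v$-path avoiding $w$. For a biconnected graph $G$ that is not a triangle, $(c,uv)\in V(G)\times E(G)$ is a vertex-edge-separator if $G-uv-c$ is disconnected; then $G-uv-c$ has exactly two components, one containing $u$, one containing $v$. For $a\in\{u,v\}$ let $C_a$ be the component containing $a$, $G_a=G[V(C_a)\cup\{c\}]$, and $b$ the other end of $uv$. If $|E(G_a)|\ge 2$, replacing $G$ by $G_a+ac$ and $G_b+ba+ac$ (two new edges $ac$, called corresponding virtual edges; $ba$ is the original edge $uv$) is a 2.5-split. $G$ is 2.5-connected if it is biconnected with no vertex-edge-separator. Performing 2.5-splits repeatedly until none is possible yields 2.5-split components (triangles, multiedges with at least 3 edges, other 2.5-connected graphs); merging (gluing along corresponding virtual edges and deleting them) the triangles as much as possible into cycles, leaving the rest unchanged, yields the 2.5-connected components of $G$.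 -}

module Defs where

open import Data.Nat using (ℕ; zero; suc; _+_; _*_; _≤_; _≡ᵇ_)
open import Data.Nat.Divisibility using (_∣_)
open import Data.Bool using (Bool; if_then_else_)
open import Data.Fin using (Fin; zero; suc; inject₁; fromℕ)
open import Data.Fin.Subset using (Subset) renaming (_∈_ to _∈ₛ_; _∉_ to _∉ₛ_; ∣_∣ to ∣_∣ₛ)
open import Data.List using (List; []; _∷_; _++_; length; lookup; map; concatMap; tabulate; allFin; removeAt)
open import Data.List.Membership.Propositional using (_∈_; _∉_)
open import Data.List.Relation.Unary.All using (All)
open import Data.List.Relation.Unary.Unique.Propositional using (Unique)
open import Data.List.Relation.Binary.Permutation.Propositional using (_↭_)
open import Data.Product using (Σ; ∃; ∃-syntax; _×_; _,_; proj₁; proj₂)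
open import Data.Sum using (_⊎_)
open import Data.Empty using (⊥)
open import Data.Unit using (⊤)
open import Function.Definitions using (Injective)
open import Relation.Nullary using (¬_)
open import Relation.Binary.PropositionalEquality using (_≡_; _≢_)
open import Relation.Binary.Construct.Closure.ReflexiveTransitive using (Star)

-- Multigraphs.  Vertices are named by natural numbers (every finite
-- graph is isomorphic to such a graph).  Edges form a list (so parallel
-- edges are allowed); an edge is identified by its position in the list
-- and carries a label of type L (L = ⊤ for plain graphs; for the
-- 2.5-split machinery L records whether an edge is original or virtual).

record MG (L : Set) : Set where
  constructor mkMG
  field
    V : List ℕ
    E : List (L × (ℕ × ℕ))
open MG public

EdgeIx : ∀ {L : Set} → MG L → Set
EdgeIx G = Fin (length (E G))

ends : ∀ {L : Set} (G : MG L) → EdgeIx G → ℕ × ℕ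
ends G i = proj₂ (lookup (E G) i)

label : ∀ {L : Set} (G : MG L) → EdgeIx G → L
label G i = proj₁ (lookup (E G) i)

WF : ∀ {L : Set} → MG L → Set
WF G = Unique (V G) × (1 ≤ length (V G))
     × All (λ e → proj₁ (proj₂ e) ∈ V G × proj₂ (proj₂ e) ∈ V G × proj₁ (proj₂ e) ≢ proj₂ (proj₂ e)) (E G)

Joins : ℕ × ℕ → ℕ → ℕ → Set
Joins (a , b) x y = (a ≡ x × b ≡ y) ⊎ (a ≡ y × b ≡ x)

Parallel : ℕ × ℕ → ℕ × ℕ → Set
Parallel (a , b) e = Joins e a b

degL : ∀ {L : Set} → ℕ → List (L × (ℕ × ℕ)) → ℕ
degL x [] = 0
degL x ((_ , (a , b)) ∷ es) =
  (if a ≡ᵇ x then 1 else 0) + ((if b ≡ᵇ x then 1 else 0) + degL x es)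

deg : ∀ {L : Set} → MG L → ℕ → ℕ
deg G x = degL x (E G)

Eulerian : ∀ {L : Set} → MG L → Set
Eulerian G = ∀ x → x ∈ V G → 2 ∣ deg G x

-- Cycles (length ≥ 2; a pair of parallel edges is a cycle of length 2).
-- A cycle of length suc k has vertices v₀ … v_k (distinct) and edges
-- e₀ … e_k (distinct), e_i joining v_i and v_{i+1}, e_k joining v_k, v₀.

record Cycle {L : Set} (G : MG L) : Set where
  field
    k     : ℕ
    k≥1   : 1 ≤ k
    vs    : Fin (suc k) → ℕ
    es    : Fin (suc k) → EdgeIx G
    vs-inj : Injective _≡_ _≡_ vs
    es-inj : Injective _≡_ _≡_ es
    joins  : ∀ (i : Fin k) → Joins (ends G (es (inject₁ i))) (vs (inject₁ i)) (vs (suc i))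
    closes : Joins (ends G (es (fromℕ k))) (vs (fromℕ k)) (vs zero)

cycleEdges : ∀ {L : Set} {G : MG L} → Cycle G → List (EdgeIx G)
cycleEdges C = tabulate (Cycle.es C)

IsCycleDecomposition : ∀ {L : Set} (G : MG L) → List (Cycle G) → Set
IsCycleDecomposition G D = concatMap cycleEdges D ↭ allFin (length (E G))

SimpleAfterRemoving : ∀ {L : Set} (G : MG L) → Subset (length (E G)) → Set
SimpleAfterRemoving G S = ∀ (i j : EdgeIx G) → i ≢ j → i ∉ₛ S → j ∉ₛ S → ¬ Parallel (ends G i) (ends G j)

-- Hajós' conjecture for H:  H Eulerian ⇒ c(H) ≤ ½(|V(H)| + m(H) − 1),
-- i.e. 2 c(H) + 1 ≤ |V(H)| + m(H).  Since c(H) is a minimum over cycle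
-- decompositions and m(H) a minimum over edge sets whose removal leaves
-- a simple graph, this says: some cycle decomposition D satisfies
-- 2|D| + 1 ≤ |V(H)| + |S| for every such edge set S.
SatisfiesHajos : ∀ {L : Set} → MG L → Set
SatisfiesHajos G = Eulerian G →
  Σ (List (Cycle G)) λ D → IsCycleDecomposition G D ×
    (∀ (S : Subset (length (E G))) → SimpleAfterRemoving G S →
       2 * length D + 1 ≤ length (V G) + ∣ S ∣ₛ)

-- Connectivity.  Reach G P Q x y: there is an x–y walk using no vertex
-- satisfying P (other than via the trivial walk) and no edge satisfying Q.

data Step {L : Set} (G : MG L) (P : ℕ → Set) (Q : EdgeIx G → Set) : ℕ → ℕ → Set where
  step : ∀ (i : EdgeIx G) {x y} → ¬ Q i → ¬ P x → ¬ P y →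
         Joins (ends G i) x y → Step G P Q x y

Reach : ∀ {L : Set} (G : MG L) (P : ℕ → Set) (Q : EdgeIx G → Set) → ℕ → ℕ → Set
Reach G P Q = Star (Step G P Q)

Connected : ∀ {L : Set} → MG L → Set
Connected G = ∀ x y → x ∈ V G → y ∈ V G → Reach G (λ _ → ⊥) (λ _ → ⊥) x y

Biconnected : ∀ {L : Set} → MG L → Set
Biconnected G = Connected G ×
  (∀ u v w → u ∈ V G → v ∈ V G → w ∈ V G → u ≢ v → u ≢ w → v ≢ w →
     Reach G (_≡ w) (λ _ → ⊥) u v)

-- a triangle: 3 vertices, 3 pairwise non-parallel edges (with WF this is
-- exactly a cycle of length 3)
Triangle : ∀ {L : Set} → MG L → Set
Triangle G = length (V G) ≡ 3 × length (E G) ≡ 3 ×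
  (∀ (i j : EdgeIx G) → i ≢ j → ¬ Parallel (ends G i) (ends G j))

VESeparator : ∀ {L : Set} (G : MG L) → ℕ → EdgeIx G → Set
VESeparator G c i = Biconnected G × ¬ Triangle G × c ∈ V G ×
  ∃[ x ] ∃[ y ] (x ∈ V G × y ∈ V G × x ≢ c × y ≢ c × ¬ Reach G (_≡ c) (_≡ i) x y)

TwoFiveConnected : ∀ {L : Set} → MG L → Set
TwoFiveConnected G = Biconnected G × (∀ c i → ¬ VESeparator G c i)

-- 2.5-splits.  Edges of split components are original or virtual;
-- corresponding virtual edges share the same number.

data Label : Set where
  orig : Label
  virt : ℕ → Label

-- vertex set of G_a = G[V(C_a) ∪ {c}] where C_a is the component of
-- G − uv − c containing a
SideOf : (G : MG Label) → ℕ → EdgeIx G → ℕ → ℕ → Set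
SideOf G c i a x = x ≡ c ⊎ Reach G (_≡ c) (_≡ i) a x

BothIn : (ℕ → Set) → Label × (ℕ × ℕ) → Set
BothIn S (_ , (x , y)) = S x × S y

-- Split G k G₁ G₂ : G₁ = G_a + ac and G₂ = G_b + ba + ac, the new pair of
-- corresponding virtual edges ac being labelled virt k.
Split : MG Label → ℕ → MG Label → MG Label → Set
Split G k G₁ G₂ =
  Σ ℕ λ c → Σ (EdgeIx G) λ i → Σ ℕ λ a → Σ ℕ λ b →
  VESeparator G c i × Joins (ends G i) a b ×
  Σ (List (Label × (ℕ × ℕ))) λ EA → Σ (List (Label × (ℕ × ℕ))) λ EB →
    -- EA = E(G_a), EB = E(G_b)   (every edge ≠ uv lies in exactly one)
    (E G ↭ lookup (E G) i ∷ (EA ++ EB)) ×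
    All (BothIn (SideOf G c i a)) EA × All (BothIn (SideOf G c i b)) EB ×
    2 ≤ length EA ×
    Unique (V G₁) × (∀ x → x ∈ V G₁ → x ∈ V G × SideOf G c i a x) ×
    (∀ x → x ∈ V G × SideOf G c i a x → x ∈ V G₁) ×
    E G₁ ≡ (virt k , (a , c)) ∷ EA ×
    Unique (V G₂) × (∀ x → x ∈ V G₂ → x ≡ a ⊎ (x ∈ V G × SideOf G c i b x)) ×
    (∀ x → x ≡ a ⊎ (x ∈ V G × SideOf G c i b x) → x ∈ V G₂) ×
    E G₂ ≡ lookup (E G) i ∷ (virt k , (a , c)) ∷ EB

labelsOf : List (MG Label) → List Label
labelsOf = concatMap (λ G → map proj₁ (E G))

SplitStep : List (MG Label) → List (MG Label) → Set
SplitStep S S′ = Σ (MG Label) λ G → Σ (List (MG Label)) λ rest →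
  Σ ℕ λ k → Σ (MG Label) λ G₁ → Σ (MG Label) λ G₂ →
  (S ↭ G ∷ rest) × virt k ∉ labelsOf S × Split G k G₁ G₂ × S′ ≡ G₁ ∷ G₂ ∷ rest

SplitTerminal : List (MG Label) → Set
SplitTerminal S = All (λ G → ∀ k G₁ G₂ → ¬ Split G k G₁ G₂) S

asLabelled : MG ⊤ → MG Label
asLabelled G = mkMG (V G) (map (λ e → orig , proj₂ e) (E G))

SplitComponents : MG ⊤ → List (MG Label) → Set
SplitComponents G S = Star SplitStep (asLabelled G ∷ []) S × SplitTerminal S

-- Merging: glue two polygons (cycles obtained from triangles) along a
-- pair of corresponding virtual edges, deleting these two edges.

Merge : MG Label → MG Label → MG Label → Set
Merge G₁ G₂ G = Σ ℕ λ k → Σ (EdgeIx G₁) λ j₁ → Σ (EdgeIx G₂) λ j₂ →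
  label G₁ j₁ ≡ virt k × label G₂ j₂ ≡ virt k ×
  Unique (V G) × (∀ x → x ∈ V G → x ∈ V G₁ ⊎ x ∈ V G₂) ×
  (∀ x → x ∈ V G₁ ⊎ x ∈ V G₂ → x ∈ V G) ×
  E G ≡ removeAt (E G₁) j₁ ++ removeAt (E G₂) j₂

MergeStep : List (MG Label) → List (MG Label) → Set
MergeStep P P′ = Σ (MG Label) λ G₁ → Σ (MG Label) λ G₂ → Σ (List (MG Label)) λ rest →
  Σ (MG Label) λ G → (P ↭ G₁ ∷ G₂ ∷ rest) × Merge G₁ G₂ G × P′ ≡ G ∷ rest

MergeTerminal : List (MG Label) → Set
MergeTerminal P = ∀ G₁ G₂ rest → P ↭ G₁ ∷ G₂ ∷ rest →
  ∀ k → virt k ∈ map proj₁ (E G₁) → virt k ∉ map proj₁ (E G₂)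

TwoFiveComponents : MG ⊤ → List (MG Label) → Set
TwoFiveComponents G F =
  Σ (List (MG Label)) λ S → Σ (List (MG Label)) λ P → Σ (List (MG Label)) λ O →
  Σ (List (MG Label)) λ P′ →
  SplitComponents G S × (S ↭ P ++ O) × All Triangle P × All (λ H → ¬ Triangle H) O ×
  Star MergeStep P P′ × MergeTerminal P′ × F ≡ P′ ++ O

{-# OPTIONS --safe #-}
module Submission where

-- In a 2.5-split along c and the edge ab, degrees keep their parity (at c by the
-- handshake lemma), so both parts are Eulerian, and the two cycles through the virtual
-- edges ac merge into one.  The cycle saved pays for the two vertices counted twice and
-- for the virtual edge possibly raising m(G_a + ac), so Hajós' conjecture passes from the
-- two parts to G.  Gluing along at most one vertex is similar, without the merging.
-- Triangles satisfy the conjecture outright, so merging them into polygons is irrelevant.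
-- For arbitrary graphs one inducts on |V| + |E|, cutting along a missing connection, a
-- cut vertex or a vertex-edge-separator, whichever exists.  If both sides of a separator
-- have at most one edge, parity forces G to be a triangle.

open import Defs
open import Data.Bool using (true; false; if_then_else_)
open import Data.Empty using (⊥; ⊥-elim)
open import Data.Fin using (Fin; zero; suc; inject₁; fromℕ)
import Data.Fin.Properties as Fin
open import Data.Fin.Subset using (Subset; ⁅_⁆; _∪_) renaming (_∈_ to _∈ₛ_; _∉_ to _∉ₛ_; ∣_∣ to ∣_∣ₛ; ⊥ to ∅)
import Data.Fin.Subset.Properties as Subset
open import Data.List using (List; []; _∷_; [_]; _++_; length; lookup; map; concat; concatMap; filter; deduplicate; tabulate; allFin; removeAt)
open import Data.List.Membership.Propositional using (_∈_; lose)
open import Data.List.Membership.Propositional.Properties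
open import Data.List.Properties
  using (map-++; map-∘; map-id; map-tabulate; tabulate-lookup; length-++; length-map; length-tabulate; length-filter; filter-notAll; concat-++; concat-map; ∷-injectiveˡ; ∷-injectiveʳ)
open import Data.List.Relation.Binary.Permutation.Propositional using (_↭_; refl; prep; ↭-trans; ↭-sym; ↭-reflexive; ↭⇒↭ₛ)
open import Data.List.Relation.Binary.Permutation.Propositional.Properties
  using (All-resp-↭; ∈-resp-↭; map⁺; ↭-map-inv; ↭-length; ++⁺; ++⁺ˡ; ++⁺ʳ; drop-∷; shift; ++-comm; ++-commutativeMonoid)
import Data.List.Relation.Binary.Permutation.Setoid.Properties as Permₛ
open import Data.List.Relation.Unary.All as All using (All; []; _∷_)
import Data.List.Relation.Unary.All.Properties as All
open import Data.List.Relation.Unary.AllPairs as AllPairs using (AllPairs; []; _∷_)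
import Data.List.Relation.Unary.AllPairs.Properties as AllPairs
open import Data.List.Relation.Unary.Any as Any using (here; there)
open import Data.List.Relation.Unary.Any.Properties using (lookup-index)
open import Data.List.Relation.Unary.Unique.Propositional using (Unique)
import Data.List.Relation.Unary.Unique.Propositional.Properties as Unique
open import Data.Nat
open import Data.Nat.Divisibility
open import Data.Nat.ListAction using (sum)
open import Data.Nat.ListAction.Properties using (sum-++; sum-↭)
open import Data.Nat.Properties
open import Data.Nat.Tactic.RingSolver using (solve-∀)
open import Data.Product using (Σ; ∃; ∃₂; _×_; _,_; proj₁; proj₂)
open import Data.Sum using (_⊎_; inj₁; inj₂; [_,_]′)
open import Data.Unit using (⊤; tt)
open import Data.Vec using ([]; _∷_)
open import Function using (_∘_; id)
open import Function.Definitions using (Injective)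
open import Relation.Binary.Construct.Closure.ReflexiveTransitive as Star using (Star; ε; _◅_; _◅◅_)
open import Relation.Binary.Definitions using (Symmetric)
open import Relation.Binary.PropositionalEquality hiding ([_])
open import Relation.Nullary using (¬_; Dec; yes; no; contradiction; ¬?)
open import Relation.Nullary.Decidable using (_×-dec_; _⊎-dec_)
open import Relation.Unary using (Decidable)
import Algebra.Solver.CommutativeMonoid as CMSolver
open import Data.List.Membership.DecPropositional _≟_ using (_∈?_)
open import Data.List.Relation.Unary.Unique.DecPropositional.Properties _≟_ using (deduplicate-!)

-- `SatisfiesHajos` speaks of edge positions and of subsets of positions, and a split renumbers all
-- of them. The argument therefore runs on `HajosL`, where edges are bare vertex pairs in a list
-- read up to permutation; parallel edges become repeated entries, and positions return only in the
-- two translation lemmas. The minimum m(H) is never computed. It enters as a bound against every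
-- way of writing the edges as `T ++ R` with `T` simple, so a simple `T` of the whole graph only has
-- to be restricted to the parts. The two claims use the splitting lemma differently. Given split
-- components come with sides defined by `Reach`, for which no decision procedure is at hand, so the
-- lemma takes arbitrary predicates for the sides. The induction over all graphs must find its
-- separators itself, and for that it replaces `Reach` by a computable component function.

module _ {A : Set} where

  open CMSolver (++-commutativeMonoid {A = A}) public using (solve; _⊕_; _⊜_)

  AllPairs-resp-↭ : {R : A → A → Set} → Symmetric R →
                    {xs ys : List A} → xs ↭ ys → AllPairs R xs → AllPairs R ys
  AllPairs-resp-↭ {R} s p = Permₛ.AllPairs-resp-↭ (setoid A) s (subst (R _) , subst (λ x → R x _)) (↭⇒↭ₛ p)

  Unique-resp-↭ : {xs ys : List A} → xs ↭ ys → Unique xs → Unique ys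
  Unique-resp-↭ = AllPairs-resp-↭ ≢-sym

  AllPairs-++⁻ : {R : A → A → Set} (xs : List A) {ys : List A} →
                 AllPairs R (xs ++ ys) → AllPairs R xs × AllPairs R ys
  AllPairs-++⁻ []       p       = [] , p
  AllPairs-++⁻ (x ∷ xs) (a ∷ p) = let q , r = AllPairs-++⁻ xs p in (All.++⁻ˡ xs a ∷ q) , r

  ∈⇒↭ : ∀ {x : A} {xs} → x ∈ xs → ∃ λ ys → xs ↭ x ∷ ys
  ∈⇒↭ {x} i with ys , zs , refl ← ∈-∃++ i = ys ++ zs , shift x ys zs

  Unique-⊆-length : ∀ {xs ys : List A} → Unique xs → (∀ {x} → x ∈ xs → x ∈ ys) → length xs ≤ length ys
  Unique-⊆-length {[]}     _       _ = z≤n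
  Unique-⊆-length {x ∷ xs} (a ∷ u) s with zs , p ← ∈⇒↭ (s (here refl)) =
    subst (suc (length xs) ≤_) (sym (↭-length p)) (s≤s (Unique-⊆-length u sub))
    where
    sub : ∀ {y} → y ∈ xs → y ∈ zs
    sub i with ∈-resp-↭ p (s (there i))
    ... | here refl = contradiction refl (All.lookup a i)
    ... | there j   = j

  filter-split : {P : A → Set} (P? : Decidable P) (xs : List A) → xs ↭ filter P? xs ++ filter (¬? ∘ P?) xs
  filter-split P? [] = refl
  filter-split P? (x ∷ xs) with P? x
  ... | yes _ = prep x (filter-split P? xs)
  ... | no  _ = ↭-trans (prep x (filter-split P? xs)) (↭-sym (shift x (filter P? xs) _))

  ++≡map : ∀ {B : Set} {f : B → A} (xs : List A) {ys} (is : List B) → xs ++ ys ≡ map f is →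
           ∃₂ λ js ks → is ≡ js ++ ks × xs ≡ map f js × ys ≡ map f ks
  ++≡map []       is       e    = [] , is , refl , refl , e
  ++≡map (x ∷ xs) (i ∷ is) e with refl ← ∷-injectiveˡ e
    with js , ks , refl , refl , refl ← ++≡map xs is (∷-injectiveʳ e) =
    i ∷ js , ks , refl , refl , refl

  -- Common refinement of two splittings of the same multiset. It distributes the kept edges `T` and
  -- the removed edges `R` of a graph over the two sides of a cut.
  ↭-refine : (ts {rs xs ys} : List A) → ts ++ rs ↭ xs ++ ys →
    Σ (List A × List A) λ (tx , ty) → Σ (List A × List A) λ (rx , ry) →
      ts ↭ tx ++ ty × rs ↭ rx ++ ry × xs ↭ tx ++ rx × ys ↭ ty ++ ry
  ↭-refine [] {rs} {xs} {ys} p = ([] , []) , (xs , ys) , refl , p , refl , refl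
  ↭-refine (t ∷ ts) {rs} {xs} {ys} p with ∈-++⁻ xs (∈-resp-↭ p (here refl))
  ... | inj₁ i with xs′ , q ← ∈⇒↭ i
    with (tx , ty) , (rx , ry) , a , b , c , d ← ↭-refine ts {rs} {xs′} {ys} (drop-∷ (↭-trans p (++⁺ʳ ys q))) =
    (t ∷ tx , ty) , (rx , ry) , prep t a , b , ↭-trans q (prep t c) , d
  ... | inj₂ i with ys′ , q ← ∈⇒↭ i
    with (tx , ty) , (rx , ry) , a , b , c , d ← ↭-refine ts {rs} {xs} {ys′}
           (drop-∷ (↭-trans p (↭-trans (++⁺ˡ xs q) (shift t xs ys′)))) =
    (tx , t ∷ ty) , (rx , ry) , ↭-trans (prep t a) (↭-sym (shift t tx ty)) , b , c , ↭-trans q (prep t d)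

-- Inclusion-exclusion: the part of `V₂` outside `V₁` fits into `V` together with `V₁`, and the part
-- inside fits into `ws`. The length of `ws` is 1 for a cut vertex and 2 for a split.
overlap-length : ∀ {V V₁ V₂ ws : List ℕ} → Unique V₁ → Unique V₂ →
  (∀ {x} → x ∈ V₁ → x ∈ V) → (∀ {x} → x ∈ V₂ → x ∈ V) → (∀ {x} → x ∈ V₁ → x ∈ V₂ → x ∈ ws) →
  length V₁ + length V₂ ≤ length V + length ws
overlap-length {V} {V₁} {V₂} {ws} u₁ u₂ s₁ s₂ m = begin
  length V₁ + length V₂                     ≡⟨ cong (length V₁ +_) (↭-length (filter-split (_∈? V₁) V₂)) ⟩
  length V₁ + length (I ++ N)               ≡⟨ cong (length V₁ +_) (length-++ I) ⟩
  length V₁ + (length I + length N)         ≡⟨ lem (length V₁) (length I) (length N) ⟩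
  (length V₁ + length N) + length I         ≡⟨ cong (_+ length I) (length-++ V₁) ⟨
  length (V₁ ++ N) + length I               ≤⟨ +-mono-≤ (Unique-⊆-length uN sN) (Unique-⊆-length (Unique.filter⁺ (_∈? V₁) u₂) sI) ⟩
  length V + length ws                      ∎
  where
  open ≤-Reasoning
  lem : ∀ a b c → a + (b + c) ≡ (a + c) + b
  lem = solve-∀
  I N : List ℕ
  I = filter (_∈? V₁) V₂
  N = filter (¬? ∘ (_∈? V₁)) V₂
  uN : Unique (V₁ ++ N)
  uN = Unique.++⁺ u₁ (Unique.filter⁺ (¬? ∘ (_∈? V₁)) u₂)
         (λ (i , j) → proj₂ (∈-filter⁻ (¬? ∘ (_∈? V₁)) {xs = V₂} j) i)
  sN : ∀ {x} → x ∈ V₁ ++ N → x ∈ V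
  sN i = [ s₁ , s₂ ∘ proj₁ ∘ ∈-filter⁻ (¬? ∘ (_∈? V₁)) {xs = V₂} ]′ (∈-++⁻ V₁ i)
  sI : ∀ {x} → x ∈ I → x ∈ ws
  sI i = let j , k = ∈-filter⁻ (_∈? V₁) {xs = V₂} i in m k j

-- Edges as vertex pairs, parallelism and simplicity

Edge : Set
Edge = ℕ × ℕ

Simple : List Edge → Set
Simple = AllPairs (λ e f → ¬ Parallel e f)

Joins-swap : ∀ {e x y} → Joins e x y → Joins e y x
Joins-swap (inj₁ p) = inj₂ p
Joins-swap (inj₂ p) = inj₁ p

Parallel-sym : ∀ {e f} → Parallel e f → Parallel f e
Parallel-sym (inj₁ (refl , refl)) = inj₁ (refl , refl)
Parallel-sym (inj₂ (refl , refl)) = inj₂ (refl , refl)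

Joins⇒Parallel : ∀ {e f x y} → Joins e x y → Joins f x y → Parallel e f
Joins⇒Parallel (inj₁ (refl , refl)) j = j
Joins⇒Parallel (inj₂ (refl , refl)) j = Joins-swap j

Joins-unique : ∀ {e x y z w} → Joins e x y → Joins e z w → (x ≡ z × y ≡ w) ⊎ (x ≡ w × y ≡ z)
Joins-unique (inj₁ (refl , refl)) j                    = j
Joins-unique (inj₂ (refl , refl)) (inj₁ (refl , refl)) = inj₂ (refl , refl)
Joins-unique (inj₂ (refl , refl)) (inj₂ (refl , refl)) = inj₁ (refl , refl)

Parallel-Joins : ∀ {e f x y} → Parallel e f → Joins e x y → Joins f x y
Parallel-Joins p (inj₁ (refl , refl)) = p
Parallel-Joins p (inj₂ (refl , refl)) = Joins-swap p

Simple-resp-↭ : ∀ {xs ys} → xs ↭ ys → Simple xs → Simple ys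
Simple-resp-↭ = AllPairs-resp-↭ (_∘ Parallel-sym)

Simple-++ˡ : ∀ {xs} ys {zs} → xs ↭ ys ++ zs → Simple xs → Simple ys
Simple-++ˡ ys p s = proj₁ (AllPairs-++⁻ ys (Simple-resp-↭ p s))

Simple-++ʳ : ∀ {xs} ys {zs} → xs ↭ ys ++ zs → Simple xs → Simple zs
Simple-++ʳ ys p s = proj₂ (AllPairs-++⁻ ys (Simple-resp-↭ p s))

Both : (ℕ → Set) → Edge → Set
Both P (x , y) = P x × P y

Both-Joins : ∀ {P : ℕ → Set} {e x y} → Both P e → Joins e x y → P x × P y
Both-Joins (p , q) (inj₁ (refl , refl)) = p , q
Both-Joins (p , q) (inj₂ (refl , refl)) = q , p

-- Degrees and parity

ind : ℕ → ℕ → ℕ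
ind a x = if a ≡ᵇ x then 1 else 0

ind-≡ : ∀ a → ind a a ≡ 1
ind-≡ zero    = refl
ind-≡ (suc a) = ind-≡ a

ind-≢ : ∀ {a x} → a ≢ x → ind a x ≡ 0
ind-≢ {zero}  {zero}  n = contradiction refl n
ind-≢ {zero}  {suc x} n = refl
ind-≢ {suc a} {zero}  n = refl
ind-≢ {suc a} {suc x} n = ind-≢ (n ∘ cong suc)

inc : ℕ → Edge → ℕ
inc x (a , b) = ind a x + ind b x

degE : ℕ → List Edge → ℕ
degE x es = sum (map (inc x) es)

degE-++ : ∀ x es fs → degE x (es ++ fs) ≡ degE x es + degE x fs
degE-++ x es fs = trans (cong sum (map-++ (inc x) es fs)) (sum-++ (map (inc x) es) (map (inc x) fs))

degE-↭ : ∀ x {es fs} → es ↭ fs → degE x es ≡ degE x fs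
degE-↭ x p = sum-↭ (map⁺ (inc x) p)

AllEven : List Edge → Set
AllEven es = ∀ x → 2 ∣ degE x es

AllEven-↭ : ∀ {es fs} → es ↭ fs → AllEven es → AllEven fs
AllEven-↭ p ev x = subst (2 ∣_) (degE-↭ x p) (ev x)

inc-Joins : ∀ {e a b} x → Joins e a b → inc x e ≡ ind a x + ind b x
inc-Joins x (inj₁ (refl , refl)) = refl
inc-Joins {a , b} x (inj₂ (refl , refl)) = +-comm (ind a x) (ind b x)

-- Comparing `x` with the ends of the edges settles the alternative without deciding `P`, so this
-- also applies to sides defined by reachability.
degE-zero : ∀ {P : ℕ → Set} {es} x → All (Both P) es → degE x es ≡ 0 ⊎ P x
degE-zero x [] = inj₁ refl
degE-zero {es = (a , b) ∷ es} x ((p , q) ∷ ps) with a ≟ x | b ≟ x | degE-zero x ps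
... | yes refl | _        | _      = inj₂ p
... | no _     | yes refl | _      = inj₂ q
... | no _     | no _     | inj₂ r = inj₂ r
... | no a≢x   | no b≢x   | inj₁ e = inj₁ (cong₂ _+_ (cong₂ _+_ (ind-≢ a≢x) (ind-≢ b≢x)) e)

sum-map-+ : ∀ {A : Set} (f g : A → ℕ) xs → sum (map (λ x → f x + g x) xs) ≡ sum (map f xs) + sum (map g xs)
sum-map-+ f g []       = refl
sum-map-+ f g (x ∷ xs) = trans (cong (f x + g x +_) (sum-map-+ f g xs)) (lem (f x) (g x) _ _)
  where
  lem : ∀ a b c d → (a + b) + (c + d) ≡ (a + c) + (b + d)
  lem = solve-∀

sum-zero : ∀ {A : Set} (f : A → ℕ) {xs} → All (λ x → f x ≡ 0) xs → sum (map f xs) ≡ 0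
sum-zero f []       = refl
sum-zero f (e ∷ es) = cong₂ _+_ e (sum-zero f es)

sum-ind : ∀ {a V} → Unique V → a ∈ V → sum (map (ind a) V) ≡ 1
sum-ind {a} (n ∷ u) (here refl) = cong₂ _+_ (ind-≡ a) (sum-zero (ind a) (All.map ind-≢ n))
sum-ind {a} (n ∷ u) (there i)   = cong₂ _+_ (ind-≢ (≢-sym (All.lookup n i))) (sum-ind u i)

handshake : ∀ {V es} → Unique V → All (Both (_∈ V)) es → 2 ∣ sum (map (λ x → degE x es) V)
handshake {V} u [] = subst (2 ∣_) (sym (sum-zero (λ _ → 0) (All.universal (λ _ → refl) V))) (2 ∣0)
handshake {V} {(a , b) ∷ es} u ((p , q) ∷ ps) =
  subst (2 ∣_) (sym eq) (∣m∣n⇒∣m+n ∣-refl (handshake u ps))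
  where
  open ≡-Reasoning
  eq : sum (map (λ x → degE x ((a , b) ∷ es)) V) ≡ 2 + sum (map (λ x → degE x es) V)
  eq = begin
    sum (map (λ x → inc x (a , b) + degE x es) V)            ≡⟨ sum-map-+ (λ x → inc x (a , b)) _ V ⟩
    sum (map (λ x → ind a x + ind b x) V) + _                ≡⟨ cong (_+ sum (map (λ x → degE x es) V)) (sum-map-+ (ind a) (ind b) V) ⟩
    sum (map (ind a) V) + sum (map (ind b) V) + _            ≡⟨ cong₂ (λ m n → m + n + _) (sum-ind u p) (sum-ind u q) ⟩
    2 + sum (map (λ x → degE x es) V)                        ∎

sum-even : ∀ {A : Set} (f : A → ℕ) {xs} → All (λ x → 2 ∣ f x) xs → 2 ∣ sum (map f xs)
sum-even f []       = 2 ∣0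
sum-even f (e ∷ es) = ∣m∣n⇒∣m+n e (sum-even f es)

endpoints : List Edge → List ℕ
endpoints []             = []
endpoints ((a , b) ∷ es) = a ∷ b ∷ endpoints es

Both-endpoints : ∀ es → All (Both (_∈ endpoints es)) es
Both-endpoints []             = []
Both-endpoints ((a , b) ∷ es) =
  (here refl , there (here refl)) ∷ All.map (λ (i , j) → there (there i) , there (there j)) (Both-endpoints es)

-- In the degree sum over `c` and all other endpoints, which is even by the handshake lemma, every
-- summand except that of `c` is known to be even. The vertex list is built from the edges, since
-- `AllEven` refers to no vertex set.
last-even : ∀ {c es} → (∀ x → x ≢ c → 2 ∣ degE x es) → AllEven es
last-even {c} {es} h x with x ≟ c
... | no n     = h x n
... | yes refl = ∣m+n∣m⇒∣n (subst (2 ∣_) (+-comm (degE c es) _) (handshake uniq all∈)) (sum-even (λ y → degE y es) evens)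
  where
  ≢c? : Decidable (_≢ c)
  ≢c? y = ¬? (y ≟ c)
  W : List ℕ
  W = filter ≢c? (deduplicate _≟_ (endpoints es))
  evens : All (λ y → 2 ∣ degE y es) W
  evens = All.map (λ {y} → h y) (All.all-filter ≢c? (deduplicate _≟_ (endpoints es)))
  uniq : Unique (c ∷ W)
  uniq = All.map ≢-sym (All.all-filter ≢c? (deduplicate _≟_ (endpoints es))) ∷ Unique.filter⁺ ≢c? (deduplicate-! (endpoints es))
  mem : ∀ {y} → y ∈ endpoints es → y ∈ c ∷ W
  mem {y} i with y ≟ c
  ... | yes refl = here refl
  ... | no n     = there (∈-filter⁺ ≢c? (∈-deduplicate⁺ _≟_ i) n)
  all∈ : All (Both (_∈ c ∷ W)) es
  all∈ = All.map (λ (i , j) → mem i , mem j) (Both-endpoints es)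

-- A vertex other than `c` gets its whole degree from one side only; `c` itself is then covered by
-- `last-even`.
AllEven-++ˡ : ∀ {PA PB : ℕ → Set} {c EA EB} → (∀ {x} → PA x → PB x → x ≡ c) →
  All (Both PA) EA → All (Both PB) EB → (∀ x → x ≢ c → 2 ∣ degE x (EA ++ EB)) → AllEven EA
AllEven-++ˡ {PA} {PB} {c} {EA} {EB} meet inA inB ev = last-even {es = EA} evA
  where
  evA : ∀ x → x ≢ c → 2 ∣ degE x EA
  evA x x≢c with degE-zero x inA | degE-zero x inB
  ... | inj₁ e | _      = subst (2 ∣_) (sym e) (2 ∣0)
  ... | inj₂ _ | inj₁ e = subst (2 ∣_) (trans (degE-++ x EA EB) (trans (cong (degE x EA +_) e) (+-identityʳ _))) (ev x x≢c)
  ... | inj₂ p | inj₂ q = contradiction (meet p q) x≢c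

AllEven-++ʳ : ∀ {PA PB : ℕ → Set} {c EA EB} → (∀ {x} → PA x → PB x → x ≡ c) →
  All (Both PA) EA → All (Both PB) EB → (∀ x → x ≢ c → 2 ∣ degE x (EA ++ EB)) → AllEven EB
AllEven-++ʳ {EA = EA} {EB} meet inA inB ev =
  AllEven-++ˡ (λ p q → meet q p) inB inA (λ x n → subst (2 ∣_) (degE-↭ x (++-comm EA EB)) (ev x n))

-- Cycles and decompositions, with edges listed by value

-- The last index lists the vertices of the walk except its final one.
data Path : ℕ → ℕ → List Edge → List ℕ → Set where
  nil  : ∀ {x} → Path x x [] []
  cons : ∀ {x y z e es ss} → Joins e x y → Path y z es ss → Path x z (e ∷ es) (x ∷ ss)

IsCyc : List Edge → Set
IsCyc es = 2 ≤ length es × ∃₂ λ x ss → Path x x es ss × Unique ss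

Path-++ : ∀ {x y z es fs ss ts} → Path x y es ss → Path y z fs ts → Path x z (es ++ fs) (ss ++ ts)
Path-++ nil        q = q
Path-++ (cons j p) q = cons j (Path-++ p q)

-- The start list of a path omits its last vertex, and reversal changes which end that is. Adding
-- the missing end on both sides makes the two vertex lists permutations of each other.
Path-reverse : ∀ {x y es ss} → Path x y es ss → ∃₂ λ fs ts → Path y x fs ts × es ↭ fs × y ∷ ss ↭ x ∷ ts
Path-reverse nil = [] , [] , nil , refl , refl
Path-reverse {x} {y} {e ∷ es} (cons {ss = ss} j p) with fs , ts , q , r , s ← Path-reverse p =
  fs ++ [ e ] , ts ++ [ _ ] , Path-++ q (cons (Joins-swap j) nil) ,
  ↭-trans (prep e r) (++-comm [ e ] fs) ,
  ↭-trans (solve 3 (λ a b c → a ⊕ (b ⊕ c) ⊜ b ⊕ (a ⊕ c)) refl [ y ] [ x ] ss)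
    (prep x (↭-trans s (++-comm [ _ ] ts)))

record PathSplit (x z : ℕ) (e : Edge) (es : List Edge) (ss : List ℕ) : Set where
  constructor pathSplit
  field
    {u w}   : ℕ
    {es₁ es₂} : List Edge
    {ss₁ ss₂} : List ℕ
    joins   : Joins e u w
    before  : Path x u es₁ ss₁
    after   : Path w z es₂ ss₂
    edges   : es ≡ es₁ ++ e ∷ es₂
    starts  : ss ≡ ss₁ ++ u ∷ ss₂

Path-split : ∀ {x z e es ss} → Path x z es ss → e ∈ es → PathSplit x z e es ss
Path-split (cons j p) (here refl) = pathSplit j nil p refl refl
Path-split (cons j p) (there i) with pathSplit k q r refl refl ← Path-split p i =
  pathSplit k (cons j q) r refl refl

Path-starts : ∀ {P : ℕ → Set} {x z es ss} → Path x z es ss → All (Both P) es → All P ss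
Path-starts nil        []       = []
Path-starts (cons j p) (b ∷ bs) = proj₁ (Both-Joins b j) ∷ Path-starts p bs

Path-nonempty : ∀ {x z es ss} → Path x z es ss → x ≢ z → 1 ≤ length es
Path-nonempty nil        n = contradiction refl n
Path-nonempty (cons _ _) _ = s≤s z≤n

-- Cutting the closed walk at `e` and rotating gives a path between the ends of `e`; it is reversed
-- if the cycle traverses `e` from `c` to `a`. The final vertex `a` is missing from `ts`, hence
-- `a ∷ ts` in the uniqueness claim.
cycle-minus-edge : ∀ {es e a c} → IsCyc es → e ∈ es → Joins e a c →
  ∃₂ λ qs ts → Path c a qs ts × Unique (a ∷ ts) × es ↭ e ∷ qs
cycle-minus-edge {e = e} (_ , x , ss , p , uniq) i j
  with pathSplit {es₁ = es₁} {es₂} {ss₁} {ss₂} k q r refl refl ← Path-split p i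
  with Joins-unique k j
... | inj₁ (refl , refl) = _ , _ , Path-++ r q ,
  Unique-resp-↭ (solve 3 (λ s u t → s ⊕ (u ⊕ t) ⊜ u ⊕ (t ⊕ s)) refl ss₁ [ _ ] ss₂) uniq ,
  solve 3 (λ s u t → s ⊕ (u ⊕ t) ⊜ u ⊕ (t ⊕ s)) refl es₁ [ e ] es₂
... | inj₂ (refl , refl) with fs , ts , q′ , r′ , s′ ← Path-reverse (Path-++ r q) = fs , ts , q′ ,
  Unique-resp-↭ (↭-trans (solve 3 (λ s u t → s ⊕ (u ⊕ t) ⊜ u ⊕ (t ⊕ s)) refl ss₁ [ _ ] ss₂) s′) uniq ,
  ↭-trans (solve 3 (λ s u t → s ⊕ (u ⊕ t) ⊜ u ⊕ (t ⊕ s)) refl es₁ [ e ] es₂) (prep e r′)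

decomposition-minus-edge : ∀ {D E e a c} → All IsCyc D → e ∷ E ↭ concat D → Joins e a c →
  ∃ λ D′ → ∃₂ λ qs ts → length D ≡ suc (length D′) × All IsCyc D′ ×
    Path c a qs ts × Unique (a ∷ ts) × E ↭ qs ++ concat D′
decomposition-minus-edge {D} {e = e} cyc p j
  with C , i , k ← ∈-concat⁻′ D (∈-resp-↭ p (here refl))
  with D₁ , D₂ , refl ← ∈-∃++ k
  with qs , ts , q , u , r ← cycle-minus-edge (All.lookup cyc k) i j =
  D₁ ++ D₂ , qs , ts , ↭-length (shift C D₁ D₂) ,
  All.++⁺ (All.++⁻ˡ D₁ cyc) (All.tail (All.++⁻ʳ D₁ cyc)) , q , u ,
  drop-∷ (↭-trans p (↭-trans (↭-reflexive (sym (concat-++ D₁ (C ∷ D₂))))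
    (↭-trans (++⁺ˡ (concat D₁) (++⁺ʳ (concat D₂) r))
      (↭-trans (solve 4 (λ s e q t → s ⊕ ((e ⊕ q) ⊕ t) ⊜ e ⊕ (q ⊕ (s ⊕ t))) refl (concat D₁) [ e ] qs (concat D₂))
        (prep e (++⁺ˡ qs (↭-reflexive (concat-++ D₁ D₂))))))))

-- HajosL n E is Hajós' conjecture for a graph with n vertices and edge list E;
-- R ranges over the edge sets whose removal leaves a simple graph.
HajosL : ℕ → List Edge → Set
HajosL n E = AllEven E → ∃ λ D → All IsCyc D × E ↭ concat D ×
  (∀ T R → E ↭ T ++ R → Simple T → 2 * length D + 1 ≤ n + length R)

HajosL-↭ : ∀ {n E F} → E ↭ F → HajosL n E → HajosL n F
HajosL-↭ p h ev with D , cyc , q , bound ← h (AllEven-↭ (↭-sym p) ev) =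
  D , cyc , ↭-trans (↭-sym p) q , λ T R r → bound T R (↭-trans p r)

-- Adding the two bounds leaves a surplus of 1, because each carries its own `+ 1`. That surplus
-- pays for one shared vertex.
HajosL-glue : ∀ {PA PB : ℕ → Set} {n n₁ n₂ c EA EB} → (∀ {x} → PA x → PB x → x ≡ c) →
  All (Both PA) EA → All (Both PB) EB → n₁ + n₂ ≤ n + 1 →
  HajosL n₁ EA → HajosL n₂ EB → HajosL n (EA ++ EB)
HajosL-glue {n = n} {n₁} {n₂} {EA = EA} {EB} meet inA inB n≤ h₁ h₂ ev
  with D₁ , cyc₁ , p₁ , bound₁ ← h₁ (AllEven-++ˡ meet inA inB (λ x _ → ev x))
  with D₂ , cyc₂ , p₂ , bound₂ ← h₂ (AllEven-++ʳ meet inA inB (λ x _ → ev x)) =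
  D₁ ++ D₂ , All.++⁺ cyc₁ cyc₂ ,
  ↭-trans (++⁺ p₁ p₂) (↭-reflexive (concat-++ D₁ D₂)) , bound
  where
  bound : ∀ T R → EA ++ EB ↭ T ++ R → Simple T → 2 * length (D₁ ++ D₂) + 1 ≤ n + length R
  bound T R p simple
    with (TA , TB) , (RA , RB) , pT , pR , pA , pB ← ↭-refine T {R} {EA} {EB} (↭-sym p) =
    +-cancelʳ-≤ 1 _ _ (begin
      2 * length (D₁ ++ D₂) + 1 + 1                    ≡⟨ cong (λ d → 2 * d + 1 + 1) (length-++ D₁) ⟩
      2 * (length D₁ + length D₂) + 1 + 1              ≡⟨ lem₁ (length D₁) (length D₂) ⟩
      (2 * length D₁ + 1) + (2 * length D₂ + 1)        ≤⟨ +-mono-≤ (bound₁ TA RA pA (Simple-++ˡ TA pT simple)) (bound₂ TB RB pB (Simple-++ʳ TA pT simple)) ⟩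
      (n₁ + length RA) + (n₂ + length RB)              ≡⟨ lem₂ n₁ (length RA) n₂ (length RB) ⟩
      (n₁ + n₂) + (length RA + length RB)              ≤⟨ +-monoˡ-≤ _ n≤ ⟩
      (n + 1) + (length RA + length RB)                ≡⟨ cong (n + 1 +_) (trans (↭-length pR) (length-++ RA)) ⟨
      (n + 1) + length R                               ≡⟨ lem₃ n (length R) ⟩
      n + length R + 1                                 ∎)
    where
    open ≤-Reasoning
    lem₁ : ∀ a b → 2 * (a + b) + 1 + 1 ≡ (2 * a + 1) + (2 * b + 1)
    lem₁ = solve-∀
    lem₂ : ∀ a b c d → (a + b) + (c + d) ≡ (a + c) + (b + d)
    lem₂ = solve-∀
    lem₃ : ∀ a b → (a + 1) + b ≡ a + b + 1
    lem₃ = solve-∀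

-- The two sides of a vertex-edge-separator (c, e) with e = ab; both PA and PB contain c.
record Separation (a b c : ℕ) (e : Edge) (EA EB : List Edge) : Set₁ where
  field
    PA PB : ℕ → Set
    meet  : ∀ {x} → PA x → PB x → x ≡ c
    aA    : PA a
    cA    : PA c
    bB    : PB b
    cB    : PB c
    a≢c   : a ≢ c
    b≢c   : b ≢ c
    ab    : Joins e a b
    inA   : All (Both PA) EA
    inB   : All (Both PB) EB

  ¬aB : ¬ PB a
  ¬aB aB = a≢c (meet aA aB)

  a≢b : a ≢ b
  a≢b refl = ¬aB bB

Separation-sym : ∀ {a b c e EA EB} → Separation a b c e EA EB → Separation b a c e EB EA
Separation-sym S = record
  { PA = PB ; PB = PA ; meet = λ p q → meet q p ; aA = bB ; cA = cB ; bB = aA ; cB = cA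
  ; a≢c = b≢c ; b≢c = a≢c ; ab = Joins-swap ab ; inA = inB ; inB = inA }
  where open Separation S

module _ {a b c e EA EB} (S : Separation a b c e EA EB) where

  open Separation S

  private
    -- Replacing the edge ab by the detour a-c-b changes the degree at `c` only. The result falls
    -- apart into two sides meeting in `c`, one virtual edge on each, so the parity lemmas for such
    -- sides apply.
    virtual-even : AllEven (e ∷ EA ++ EB) → ∀ x → x ≢ c → 2 ∣ degE x (((a , c) ∷ EA) ++ ((b , c) ∷ EB))
    virtual-even ev x x≢c = subst (2 ∣_) eq (ev x)
      where
      open ≡-Reasoning
      lem : ∀ i j m n → (i + j) + (m + n) ≡ (i + 0 + m) + (j + 0 + n)
      lem = solve-∀
      eq : degE x (e ∷ EA ++ EB) ≡ degE x (((a , c) ∷ EA) ++ ((b , c) ∷ EB))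
      eq = begin
        inc x e + degE x (EA ++ EB)
          ≡⟨ cong₂ _+_ (inc-Joins x ab) (degE-++ x EA EB) ⟩
        (ind a x + ind b x) + (degE x EA + degE x EB)
          ≡⟨ lem (ind a x) (ind b x) _ _ ⟩
        (ind a x + 0 + degE x EA) + (ind b x + 0 + degE x EB)
          ≡⟨ cong (λ i → (ind a x + i + degE x EA) + (ind b x + i + degE x EB)) (ind-≢ (≢-sym x≢c)) ⟨
        degE x ((a , c) ∷ EA) + degE x ((b , c) ∷ EB)
          ≡⟨ degE-++ x ((a , c) ∷ EA) ((b , c) ∷ EB) ⟨
        degE x (((a , c) ∷ EA) ++ ((b , c) ∷ EB)) ∎

  AllEven-sideA : AllEven (e ∷ EA ++ EB) → AllEven ((a , c) ∷ EA)
  AllEven-sideA ev = AllEven-++ˡ meet ((aA , cA) ∷ inA) ((bB , cB) ∷ inB) (virtual-even ev)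

  AllEven-sideB : AllEven (e ∷ EA ++ EB) → AllEven ((b , c) ∷ EB)
  AllEven-sideB ev = AllEven-++ʳ meet ((aA , cA) ∷ inA) ((bB , cB) ∷ inB) (virtual-even ev)

  -- The second part of a split is the side of `b` with the virtual edge bc subdivided by `a`, which
  -- adds 2 to the degree of `a` and nothing elsewhere.
  AllEven-subdividedB : AllEven (e ∷ EA ++ EB) → AllEven (e ∷ (a , c) ∷ EB)
  AllEven-subdividedB ev x = subst (2 ∣_) (sym eq) (∣m∣n⇒∣m+n (m∣m*n (ind a x)) (AllEven-sideB ev x))
    where
    lem : ∀ i j k n → (i + j) + ((i + k) + n) ≡ 2 * i + ((j + k) + n)
    lem = solve-∀
    eq : degE x (e ∷ (a , c) ∷ EB) ≡ 2 * ind a x + degE x ((b , c) ∷ EB)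
    eq = trans (cong (_+ degE x ((a , c) ∷ EB)) (inc-Joins x ab)) (lem (ind a x) (ind b x) (ind c x) (degE x EB))

  -- The two cycles through the virtual edge ac become one cycle of G, which pays for
  -- the virtual edge being possibly counted in m(G₁).
  HajosL-split : ∀ {n n₁ n₂} → n₁ + n₂ ≤ n + 2 →
    HajosL n₁ ((a , c) ∷ EA) → HajosL n₂ (e ∷ (a , c) ∷ EB) → HajosL n (e ∷ EA ++ EB)
  HajosL-split {n} {n₁} {n₂} n≤ h₁ h₂ ev
    with D₁ , cyc₁ , p₁ , bound₁ ← h₁ (AllEven-sideA ev)
    with D₂ , cyc₂ , p₂ , bound₂ ← h₂ (AllEven-subdividedB ev)
    with D₁′ , q₁ , t₁ , l₁ , cyc₁′ , path₁ , uniq₁ , r₁ ← decomposition-minus-edge {a = a} {c} cyc₁ p₁ (inj₁ (refl , refl))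
    with D₂′ , q₂ , t₂ , l₂ , cyc₂′ , path₂ , uniq₂ , r₂ ← decomposition-minus-edge {a = c} {a} cyc₂
           (↭-trans (solve 3 (λ x y z → y ⊕ (x ⊕ z) ⊜ x ⊕ (y ⊕ z)) refl [ e ] [ (a , c) ] EB) p₂) (inj₂ (refl , refl)) =
    (q₁ ++ q₂) ∷ D₁′ ++ D₂′ , (long , c , _ , Path-++ path₁ path₂ , uniq) ∷ All.++⁺ cyc₁′ cyc₂′ ,
    ↭-trans perm (++⁺ˡ (q₁ ++ q₂) (↭-reflexive (concat-++ D₁′ D₂′))) , bound
    where
    long : 2 ≤ length (q₁ ++ q₂)
    long = subst (2 ≤_) (sym (length-++ q₁)) (+-mono-≤ (Path-nonempty path₁ (≢-sym a≢c)) (Path-nonempty path₂ a≢c))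
    vs₁ : All PA t₁
    vs₁ = Path-starts path₁ (All.++⁻ˡ q₁ (All-resp-↭ r₁ inA))
    inB′ : All (Both (λ x → PB x ⊎ x ≡ a)) (e ∷ EB)
    inB′ = e∈ ab ∷ All.map (λ (p , q) → inj₁ p , inj₁ q) inB
      where
      e∈ : Joins e a b → Both (λ x → PB x ⊎ x ≡ a) e
      e∈ (inj₁ (refl , refl)) = inj₂ refl , inj₁ bB
      e∈ (inj₂ (refl , refl)) = inj₁ bB , inj₂ refl
    vs₂ : All (λ x → PB x ⊎ x ≡ a) t₂
    vs₂ = Path-starts path₂ (All.++⁻ˡ q₂ (All-resp-↭ r₂ inB′))
    uniq : Unique (t₁ ++ t₂)
    uniq = Unique.++⁺ (AllPairs.tail uniq₁) (AllPairs.tail uniq₂) λ (i , j) → disj i j (All.lookup vs₂ j)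
      where
      -- The parts share only `a` and `c`. The path from `c` to `a` does not list its end `a`, and
      -- the path from `a` to `c` does not list its end `c`, so each of the two appears once.
      disj : ∀ {x} → x ∈ t₁ → x ∈ t₂ → PB x ⊎ x ≡ a → ⊥
      disj i j (inj₁ q) with refl ← meet (All.lookup vs₁ i) q = All.lookup (AllPairs.head uniq₂) j refl
      disj i j (inj₂ refl) = All.lookup (AllPairs.head uniq₁) i refl
    perm : e ∷ EA ++ EB ↭ (q₁ ++ q₂) ++ (concat D₁′ ++ concat D₂′)
    perm = ↭-trans (solve 3 (λ x y z → x ⊕ (y ⊕ z) ⊜ y ⊕ (x ⊕ z)) refl [ e ] EA EB)
      (↭-trans (++⁺ r₁ r₂)
        (solve 4 (λ x y z w → (x ⊕ y) ⊕ (z ⊕ w) ⊜ (x ⊕ z) ⊕ (y ⊕ w)) refl q₁ (concat D₁′) q₂ (concat D₂′)))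
    bound : ∀ T R → e ∷ EA ++ EB ↭ T ++ R → Simple T → 2 * suc (length (D₁′ ++ D₂′)) + 1 ≤ n + length R
    bound T R p simple
      with (tx , ty) , (rx , ry) , pT , pR , _ , p′ ← ↭-refine T {R} {[ e ]} {EA ++ EB} (↭-sym p)
      with (TA , TB) , (RA , RB) , pT′ , pR′ , pA , pB ← ↭-refine ty {ry} {EA} {EB} (↭-sym p′) =
      -- The 3 is 2 for the cycle saved and 1 for the second `+ 1`. It is used up by the 2 in `n≤`
      -- and by the virtual edge counted as removed on the side of `a`.
      +-cancelʳ-≤ 3 _ _ (begin
        2 * suc (length (D₁′ ++ D₂′)) + 1 + 3                       ≡⟨ cong (λ d → 2 * suc d + 1 + 3) (length-++ D₁′) ⟩
        2 * suc (length D₁′ + length D₂′) + 1 + 3                   ≡⟨ lem₁ (length D₁′) (length D₂′) ⟩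
        (2 * suc (length D₁′) + 1) + (2 * suc (length D₂′) + 1)     ≡⟨ cong₂ (λ i j → (2 * i + 1) + (2 * j + 1)) l₁ l₂ ⟨
        (2 * length D₁ + 1) + (2 * length D₂ + 1)
          ≤⟨ +-mono-≤ (bound₁ TA ((a , c) ∷ RA) (↭-trans (prep (a , c) pA) (↭-sym (shift (a , c) TA RA))) simpleA)
                      (bound₂ (e ∷ (a , c) ∷ TB) RB (prep e (prep (a , c) pB)) simpleB) ⟩
        (n₁ + suc (length RA)) + (n₂ + length RB)                   ≡⟨ lem₂ n₁ (length RA) n₂ (length RB) ⟩
        (n₁ + n₂) + (length RA + length RB) + 1                     ≤⟨ +-monoˡ-≤ 1 (+-mono-≤ n≤ R≤) ⟩
        (n + 2) + length R + 1                                      ≡⟨ lem₃ n (length R) ⟩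
        n + length R + 3                                            ∎)
      where
      open ≤-Reasoning
      lem₁ : ∀ a b → 2 * suc (a + b) + 1 + 3 ≡ (2 * suc a + 1) + (2 * suc b + 1)
      lem₁ = solve-∀
      lem₂ : ∀ a b c d → (a + suc b) + (c + d) ≡ (a + c) + (b + d) + 1
      lem₂ = solve-∀
      lem₃ : ∀ a b → (a + 2) + b + 1 ≡ a + b + 3
      lem₃ = solve-∀
      R≤ : length RA + length RB ≤ length R
      R≤ = begin
        length RA + length RB ≡⟨ trans (↭-length pR′) (length-++ RA) ⟨
        length ry             ≤⟨ m≤n+m _ (length rx) ⟩
        length rx + length ry ≡⟨ trans (↭-length pR) (length-++ rx) ⟨
        length R              ∎
      simple-ty : Simple ty
      simple-ty = Simple-++ʳ tx pT simple
      simpleA : Simple TA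
      simpleA = Simple-++ˡ TA pT′ simple-ty
      inTB : All (Both PB) TB
      inTB = All.++⁻ˡ TB (All-resp-↭ pB inB)
      ¬joins-a : ∀ {f y} → Both PB f → ¬ Joins f a y
      ¬joins-a q j = ¬aB (proj₁ (Both-Joins q j))
      -- Here the virtual edge is kept and costs nothing: no edge of `TB` touches `a`, and the two
      -- edges at `a` have the distinct other ends `b` and `c`. An edge `e` removed by `R` may be
      -- put back for the same reason.
      simpleB : Simple (e ∷ (a , c) ∷ TB)
      simpleB = (e∦ac ∷ All.map (λ q par → ¬joins-a q (Parallel-Joins par ab)) inTB) ∷
                All.map (λ q → ¬joins-a q) inTB ∷ Simple-++ʳ TA pT′ simple-ty
        where
        e∦ac : ¬ Parallel e (a , c)
        e∦ac par with Parallel-Joins par ab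
        ... | inj₁ (_ , refl) = b≢c refl
        ... | inj₂ (refl , _) = a≢b refl

HajosL-triangle : ∀ {n e f g a b c} → Joins e a b → Joins f b c → Joins g c a →
  a ≢ b → b ≢ c → c ≢ a → 3 ≤ n → HajosL n (e ∷ f ∷ g ∷ [])
HajosL-triangle {n} {a = a} {b} {c} je jf jg a≢b b≢c c≢a n≥3 _ =
  [ _ ] , (s≤s (s≤s z≤n) , a , _ , cons je (cons jf (cons jg nil)) , uniq) ∷ [] , refl ,
  λ T R _ _ → m≤n⇒m≤n+o (length R) n≥3
  where
  uniq : Unique (a ∷ b ∷ c ∷ [])
  uniq = (a≢b ∷ ≢-sym c≢a ∷ []) ∷ (b≢c ∷ []) ∷ [] ∷ []

-- Positions versus values

edges : ∀ {L} → MG L → List Edge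
edges G = map proj₂ (E G)

map-ends-allFin : ∀ {L} (G : MG L) → map (ends G) (allFin (length (E G))) ≡ edges G
map-ends-allFin G = begin
  map (ends G) (tabulate id)              ≡⟨ map-tabulate id (ends G) ⟩
  tabulate (proj₂ ∘ lookup (E G))         ≡⟨ map-tabulate (lookup (E G)) proj₂ ⟨
  map proj₂ (tabulate (lookup (E G)))     ≡⟨ cong (map proj₂) (tabulate-lookup (E G)) ⟩
  edges G                                 ∎
  where open ≡-Reasoning

degL≡degE : ∀ {L : Set} x (es : List (L × Edge)) → degL x es ≡ degE x (map proj₂ es)
degL≡degE x [] = refl
degL≡degE x ((_ , (a , b)) ∷ es) =
  trans (cong (λ d → ind a x + (ind b x + d)) (degL≡degE x es)) (sym (+-assoc (ind a x) _ _))

WF⇒Both : ∀ {L} {G : MG L} → WF G → All (Both (_∈ V G)) (edges G)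
WF⇒Both (_ , _ , ok) = All.map⁺ (All.map (λ (p , q , _) → p , q) ok)

AllEven⇒Eulerian : ∀ {L} {G : MG L} → AllEven (edges G) → Eulerian G
AllEven⇒Eulerian {G = G} ev x _ = subst (2 ∣_) (sym (degL≡degE x (E G))) (ev x)

Eulerian⇒AllEven : ∀ {L} {G : MG L} → WF G → Eulerian G → AllEven (edges G)
Eulerian⇒AllEven {G = G} wf eu x with degE-zero x (WF⇒Both {G = G} wf)
... | inj₁ e = subst (2 ∣_) (sym e) (2 ∣0)
... | inj₂ i = subst (2 ∣_) (degL≡degE x (E G)) (eu x i)

tabulate-Path : ∀ {k z} (v : Fin (suc k) → ℕ) (e : Fin (suc k) → Edge) →
  (∀ i → Joins (e (inject₁ i)) (v (inject₁ i)) (v (suc i))) → Joins (e (fromℕ k)) (v (fromℕ k)) z →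
  Path (v zero) z (tabulate e) (tabulate v)
tabulate-Path {zero}  v e joins closes = cons closes nil
tabulate-Path {suc k} v e joins closes =
  cons (joins zero) (tabulate-Path (v ∘ suc) (e ∘ suc) (joins ∘ suc) closes)

Path-tabulate : ∀ {I : Set} (f : I → Edge) i is {x z ss} → Path x z (map f (i ∷ is)) ss →
  Σ (Fin (suc (length is)) → ℕ) λ v → tabulate v ≡ ss × v zero ≡ x ×
    (∀ j → Joins (f (lookup (i ∷ is) (inject₁ j))) (v (inject₁ j)) (v (suc j))) ×
    Joins (f (lookup (i ∷ is) (fromℕ (length is)))) (v (fromℕ (length is))) z
Path-tabulate f i []       {x} (cons j nil) = (λ _ → x) , refl , refl , (λ ()) , j
Path-tabulate f i (i′ ∷ is) {x} (cons j p) with v , refl , refl , joins , closes ← Path-tabulate f i′ is p =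
  v′ , refl , refl , joins′ , closes
  where
  v′ : Fin (suc (suc (length is))) → ℕ
  v′ zero    = x
  v′ (suc n) = v n
  joins′ : ∀ n → Joins (f (lookup (i ∷ i′ ∷ is) (inject₁ n))) (v′ (inject₁ n)) (v′ (suc n))
  joins′ zero    = j
  joins′ (suc n) = joins n

Unique-lookup-injective : ∀ {A : Set} {xs : List A} → Unique xs → Injective _≡_ _≡_ (lookup xs)
Unique-lookup-injective (n ∷ u) {zero}  {zero}  _ = refl
Unique-lookup-injective {xs = x ∷ xs} (n ∷ u) {zero}  {suc j} e = contradiction e (All.lookup n (∈-lookup {xs = xs} j))
Unique-lookup-injective {xs = x ∷ xs} (n ∷ u) {suc i} {zero}  e = contradiction (sym e) (All.lookup n (∈-lookup {xs = xs} i))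
Unique-lookup-injective (n ∷ u) {suc i} {suc j} e = cong suc (Unique-lookup-injective u e)

Unique-tabulate⁻ : ∀ {A : Set} {n} {f : Fin n → A} → Unique (tabulate f) → Injective _≡_ _≡_ f
Unique-tabulate⁻ (n ∷ u) {zero}  {zero}  _ = refl
Unique-tabulate⁻ (n ∷ u) {zero}  {suc j} e = contradiction e (All.tabulate⁻ n j)
Unique-tabulate⁻ (n ∷ u) {suc i} {zero}  e = contradiction (sym e) (All.tabulate⁻ n i)
Unique-tabulate⁻ (n ∷ u) {suc i} {suc j} e = cong suc (Unique-tabulate⁻ u e)

module _ {L : Set} {G : MG L} where

  Cycle⇒IsCyc : (C : Cycle G) → IsCyc (map (ends G) (cycleEdges C))
  Cycle⇒IsCyc C = subst IsCyc (sym (map-tabulate es (ends G)))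
    ( subst (2 ≤_) (sym (length-tabulate (ends G ∘ es))) (s≤s k≥1)
    , vs zero , tabulate vs , tabulate-Path vs (ends G ∘ es) joins closes , Unique.tabulate⁺ vs-inj)
    where open Cycle C

  IsCyc⇒Cycle : ∀ is → Unique is → IsCyc (map (ends G) is) → Σ (Cycle G) λ C → cycleEdges C ≡ is
  IsCyc⇒Cycle (i ∷ is) u (s≤s len , x , _ , p , uv) with v , refl , refl , joins , closes ← Path-tabulate (ends G) i is p =
    record
      { k = length is ; k≥1 = subst (1 ≤_) (length-map (ends G) is) len
      ; vs = v ; es = lookup (i ∷ is)
      ; vs-inj = Unique-tabulate⁻ uv ; es-inj = Unique-lookup-injective u
      ; joins = joins ; closes = closes } ,
    tabulate-lookup (i ∷ is)

  -- The position list `is` is cut into blocks matching the cycles of `D`. Its uniqueness supplies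
  -- the distinctness of edges that value lists cannot express when edges are parallel.
  IsCycs⇒Cycles : ∀ D is → All IsCyc D → concat D ≡ map (ends G) is → Unique is →
    Σ (List (Cycle G)) λ D′ → concatMap cycleEdges D′ ≡ is × length D′ ≡ length D
  IsCycs⇒Cycles [] [] _ _ _ = [] , refl , refl
  IsCycs⇒Cycles (es ∷ D) is (c ∷ cs) e u
    with js , ks , refl , refl , e′ ← ++≡map es is e
    with uj , uk ← AllPairs-++⁻ js u
    with C , refl ← IsCyc⇒Cycle js uj c
    with D′ , refl , l ← IsCycs⇒Cycles D ks cs e′ uk =
    C ∷ D′ , refl , cong suc l

∣∪∣≤+ : ∀ {n} (p q : Subset n) → ∣ p ∪ q ∣ₛ ≤ ∣ p ∣ₛ + ∣ q ∣ₛ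
∣∪∣≤+ []          []          = z≤n
∣∪∣≤+ (true ∷ p)  (true ∷ q)  = s≤s (≤-trans (∣∪∣≤+ p q) (+-monoʳ-≤ _ (n≤1+n _)))
∣∪∣≤+ (true ∷ p)  (false ∷ q) = s≤s (∣∪∣≤+ p q)
∣∪∣≤+ (false ∷ p) (true ∷ q)  = ≤-trans (s≤s (∣∪∣≤+ p q)) (≤-reflexive (sym (+-suc _ _)))
∣∪∣≤+ (false ∷ p) (false ∷ q) = ∣∪∣≤+ p q

fromList : ∀ {n} → List (Fin n) → Subset n
fromList []       = ∅
fromList (i ∷ is) = ⁅ i ⁆ ∪ fromList is

∈-fromList : ∀ {n} {i : Fin n} {is} → i ∈ is → i ∈ₛ fromList is
∈-fromList (here refl) = Subset.x∈p∪q⁺ (inj₁ (Subset.x∈⁅x⁆ _))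
∈-fromList (there i)   = Subset.x∈p∪q⁺ (inj₂ (∈-fromList i))

∣fromList∣ : ∀ {n} (is : List (Fin n)) → ∣ fromList is ∣ₛ ≤ length is
∣fromList∣ {n} []  = ≤-reflexive (Subset.∣⊥∣≡0 n)
∣fromList∣ (i ∷ is) = begin
  ∣ ⁅ i ⁆ ∪ fromList is ∣ₛ            ≤⟨ ∣∪∣≤+ ⁅ i ⁆ (fromList is) ⟩
  ∣ ⁅ i ⁆ ∣ₛ + ∣ fromList is ∣ₛ       ≡⟨ cong (_+ ∣ fromList is ∣ₛ) (Subset.∣⁅x⁆∣≡1 i) ⟩
  suc ∣ fromList is ∣ₛ               ≤⟨ s≤s (∣fromList∣ is) ⟩
  suc (length is)                    ∎
  where open ≤-Reasoning

Unique-length-≤ : ∀ {n} {S : Subset n} {is} → Unique is → All (_∈ₛ S) is → length is ≤ ∣ S ∣ₛ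
Unique-length-≤ []      []       = z≤n
Unique-length-≤ (n ∷ u) (i ∷ is) = ≤-trans
  (s≤s (Unique-length-≤ u (All.zipWith (λ (x≢y , y∈S) → Subset.x∈p∧x≢y⇒x∈p-y y∈S (≢-sym x≢y)) (n , is))))
  (Subset.x∈p⇒∣p-x∣<∣p∣ i)

AllPairs-lookup : ∀ {A : Set} {R : A → A → Set} {xs x y} → Symmetric R → AllPairs R xs → x ∈ xs → y ∈ xs → x ≢ y → R x y
AllPairs-lookup s (a ∷ p) (here refl) (here refl) n = contradiction refl n
AllPairs-lookup s (a ∷ p) (here refl) (there j)   n = All.lookup a j
AllPairs-lookup s (a ∷ p) (there i)   (here refl) n = s (All.lookup a i)
AllPairs-lookup s (a ∷ p) (there i)   (there j)   n = AllPairs-lookup s p i j n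

Unique⇒AllPairs : ∀ {A : Set} {P : A → Set} {R : A → A → Set} {xs} → Unique xs → All P xs →
  (∀ {x y} → x ≢ y → P x → P y → R x y) → AllPairs R xs
Unique⇒AllPairs []      []       h = []
Unique⇒AllPairs (n ∷ u) (p ∷ ps) h = All.zipWith (λ (n , q) → h n p q) (n , ps) ∷ Unique⇒AllPairs u ps h

-- Since `edges G` is the image of the list of all positions, a splitting `T ++ R` of the values
-- lifts to a splitting `ts ++ rs` of the positions. Which of several equal entries is chosen does
-- not matter; `rs` becomes the subset to test.
SatisfiesHajos⇒HajosL : ∀ {L} {G : MG L} → SatisfiesHajos G → HajosL (length (V G)) (edges G)
SatisfiesHajos⇒HajosL {G = G} h ev with D , dec , bound ← h (AllEven⇒Eulerian {G = G} ev) =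
  map (map (ends G)) (map cycleEdges D) ,
  All.map⁺ (All.map⁺ (All.universal Cycle⇒IsCyc D)) ,
  subst₂ _↭_ (map-ends-allFin G) (sym (concat-map (map cycleEdges D))) (map⁺ (ends G) (↭-sym dec)) ,
  λ T R p simple → subst (λ d → 2 * d + 1 ≤ length (V G) + length R)
    (sym (trans (length-map (map (ends G)) (map cycleEdges D)) (length-map cycleEdges D))) (bound′ D bound T R p simple)
  where
  bound′ : ∀ D → (∀ S → SimpleAfterRemoving G S → 2 * length D + 1 ≤ length (V G) + ∣ S ∣ₛ) →
    ∀ T R → edges G ↭ T ++ R → Simple T → 2 * length D + 1 ≤ length (V G) + length R
  bound′ D bound T R p simple
    with is , e , q ← ↭-map-inv (ends G) (subst (_↭ T ++ R) (sym (map-ends-allFin G)) p)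
    with ts , rs , refl , refl , refl ← ++≡map T is e =
    ≤-trans (bound (fromList rs) simple′) (+-monoʳ-≤ _ (≤-trans (∣fromList∣ rs) (≤-reflexive (sym (length-map (ends G) rs)))))
    where
    kept : ∀ i → i ∉ₛ fromList rs → i ∈ ts
    kept i n with ∈-++⁻ ts (∈-resp-↭ q (∈-allFin i))
    ... | inj₁ j = j
    ... | inj₂ j = contradiction (∈-fromList j) n
    simple′ : SimpleAfterRemoving G (fromList rs)
    simple′ i j i≢j ni nj = AllPairs-lookup {R = λ i j → ¬ Parallel (ends G i) (ends G j)}
      (_∘ Parallel-sym) (AllPairs.map⁻ simple) (kept i ni) (kept j nj) i≢j

-- Well-formedness bridges two notions of parity: `Eulerian` looks at the vertices in `V G`,
-- `AllEven` at all numbers, and outside `V G` the degree is 0.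
HajosL⇒SatisfiesHajos : ∀ {L} {G : MG L} → WF G → HajosL (length (V G)) (edges G) → SatisfiesHajos G
HajosL⇒SatisfiesHajos {G = G} wf h eu
  with D , cyc , p , bound ← h (Eulerian⇒AllEven {G = G} wf eu)
  with is , e , q ← ↭-map-inv (ends G) (subst (_↭ concat D) (sym (map-ends-allFin G)) p)
  with D′ , refl , l ← IsCycs⇒Cycles {G = G} D is cyc e (Unique-resp-↭ q (Unique.allFin⁺ _)) =
  D′ , ↭-sym q , λ S simple → subst (λ d → 2 * d + 1 ≤ length (V G) + ∣ S ∣ₛ) (sym l) (bound′ S simple)
  where
  bound′ : ∀ S → SimpleAfterRemoving G S → 2 * length D + 1 ≤ length (V G) + ∣ S ∣ₛ
  bound′ S simple = ≤-trans
    (bound (map (ends G) ts) (map (ends G) rs)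
      (subst₂ _↭_ (map-ends-allFin G) (map-++ (ends G) ts rs)
        (map⁺ (ends G) (↭-trans (filter-split (Subset._∈? S) _) (++-comm rs ts))))
      (AllPairs.map⁺ (Unique⇒AllPairs (Unique.filter⁺ ∉? (Unique.allFin⁺ _)) (All.all-filter ∉? (allFin (length (E G)))) (simple _ _))))
    (+-monoʳ-≤ _ (≤-trans (≤-reflexive (length-map (ends G) rs))
      (Unique-length-≤ (Unique.filter⁺ (Subset._∈? S) (Unique.allFin⁺ _)) (All.all-filter (Subset._∈? S) (allFin (length (E G)))))))
    where
    ∉? : Decidable (_∉ₛ S)
    ∉? = ¬? ∘ (Subset._∈? S)
    ts rs : List (EdgeIx G)
    ts = filter ∉? (allFin (length (E G)))
    rs = filter (Subset._∈? S) (allFin (length (E G)))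

-- Triangles

module _ {x y z : ℕ} where

  TriangleSide : Edge → Set
  TriangleSide e = Joins e x y ⊎ Joins e y z ⊎ Joins e z x

  triangleSide : ∀ {a b} → a ∈ x ∷ y ∷ z ∷ [] → b ∈ x ∷ y ∷ z ∷ [] → a ≢ b → TriangleSide (a , b)
  triangleSide (here refl)                 (here refl)                 n = contradiction refl n
  triangleSide (here refl)                 (there (here refl))         n = inj₁ (inj₁ (refl , refl))
  triangleSide (here refl)                 (there (there (here refl))) n = inj₂ (inj₂ (inj₂ (refl , refl)))
  triangleSide (there (here refl))         (here refl)                 n = inj₁ (inj₂ (refl , refl))
  triangleSide (there (here refl))         (there (here refl))         n = contradiction refl n
  triangleSide (there (here refl))         (there (there (here refl))) n = inj₂ (inj₁ (inj₁ (refl , refl)))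
  triangleSide (there (there (here refl))) (here refl)                 n = inj₂ (inj₂ (inj₁ (refl , refl)))
  triangleSide (there (there (here refl))) (there (here refl))         n = inj₂ (inj₁ (inj₂ (refl , refl)))
  triangleSide (there (there (here refl))) (there (there (here refl))) n = contradiction refl n

TriangleSide-rotate : ∀ {x y z e} → TriangleSide {x} {y} {z} e → TriangleSide {y} {z} {x} e
TriangleSide-rotate (inj₁ j)        = inj₂ (inj₂ j)
TriangleSide-rotate (inj₂ (inj₁ j)) = inj₁ j
TriangleSide-rotate (inj₂ (inj₂ j)) = inj₂ (inj₁ j)

-- Three pairwise non-parallel edges occupy the three sides once each, so they form one cycle, and 2
-- · 1 + 1 = 3 ≤ n. Rotating the names reduces to the case that `e` is the side xy.
HajosL-three-sides : ∀ {n x y z e f g} → 3 ≤ n → x ≢ y → y ≢ z → z ≢ x →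
  ¬ Parallel e f → ¬ Parallel e g → ¬ Parallel f g →
  TriangleSide {x} {y} {z} e → TriangleSide {x} {y} {z} f → TriangleSide {x} {y} {z} g → HajosL n (e ∷ f ∷ g ∷ [])
HajosL-three-sides {e = e} {f} {g} n≥3 x≢y y≢z z≢x ef eg fg = λ where
    (inj₁ i)        j k → first x≢y y≢z z≢x i j k
    (inj₂ (inj₁ i)) j k → first y≢z z≢x x≢y i (TriangleSide-rotate j) (TriangleSide-rotate k)
    (inj₂ (inj₂ i)) j k → first z≢x x≢y y≢z i (TriangleSide-rotate (TriangleSide-rotate j)) (TriangleSide-rotate (TriangleSide-rotate k))
  where
  first : ∀ {x y z} → x ≢ y → y ≢ z → z ≢ x →
    Joins e x y → TriangleSide {x} {y} {z} f → TriangleSide {x} {y} {z} g → HajosL _ (e ∷ f ∷ g ∷ [])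
  first xy yz zx i (inj₁ j)        k               = contradiction (Joins⇒Parallel i j) ef
  first xy yz zx i (inj₂ j)        (inj₁ k)        = contradiction (Joins⇒Parallel i k) eg
  first xy yz zx i (inj₂ (inj₁ j)) (inj₂ (inj₁ k)) = contradiction (Joins⇒Parallel j k) fg
  first xy yz zx i (inj₂ (inj₂ j)) (inj₂ (inj₂ k)) = contradiction (Joins⇒Parallel j k) fg
  first xy yz zx i (inj₂ (inj₁ j)) (inj₂ (inj₂ k)) = HajosL-triangle i j k xy yz zx n≥3
  first xy yz zx i (inj₂ (inj₂ j)) (inj₂ (inj₁ k)) =
    HajosL-↭ (prep e (_↭_.swap g f refl)) (HajosL-triangle i k j xy yz zx n≥3)

Good : ∀ {L} → MG L → Set
Good G = HajosL (length (V G)) (edges G)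

Triangle⇒Good : ∀ {L} {G : MG L} → WF G → Triangle G → Good G
Triangle⇒Good {G = mkMG (x ∷ y ∷ z ∷ []) (e ∷ f ∷ g ∷ [])}
  (((x≢y ∷ x≢z ∷ []) ∷ (y≢z ∷ []) ∷ _) , _ , ((e₁ , e₂ , e≢) ∷ (f₁ , f₂ , f≢) ∷ (g₁ , g₂ , g≢) ∷ [])) (refl , refl , ∦) =
  HajosL-three-sides ≤-refl x≢y y≢z (≢-sym x≢z)
    (∦ zero (suc zero) λ ()) (∦ zero (suc (suc zero)) λ ()) (∦ (suc zero) (suc (suc zero)) λ ())
    (triangleSide e₁ e₂ e≢) (triangleSide f₁ f₂ f≢) (triangleSide g₁ g₂ g≢)

-- 2.5-splits

Reach-sym : ∀ {L} {G : MG L} {P Q x y} → Reach G P Q x y → Reach G P Q y x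
Reach-sym = Star.reverse λ { (step i nq nx ny j) → step i nq ny nx (Joins-swap j) }

module _ {L} {G : MG L} {c : ℕ} {i : EdgeIx G} where

  reroute : ∀ {x y} → (∀ {u v} → u ≢ c → v ≢ c → Joins (ends G i) u v → Reach G (_≡ c) (_≡ i) u v) →
    Reach G (_≡ c) (λ _ → ⊥) x y → Reach G (_≡ c) (_≡ i) x y
  reroute detour ε = ε
  reroute detour (step j _ nx ny jn ◅ r) with j Fin.≟ i
  ... | yes refl = detour nx ny jn ◅◅ reroute detour r
  ... | no n     = step j n nx ny jn ◅ reroute detour r

  -- In G - c there is a path from `x` to `y`, so edge `i` must be indispensable for it. If `i`
  -- ended in `c`, no such path could use it; if its ends were still connected without it, `reroute`
  -- would bypass it.
  separator-ends : ∀ {x y a b} → Biconnected G → c ∈ V G → x ∈ V G → y ∈ V G → x ≢ c → y ≢ c →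
    ¬ Reach G (_≡ c) (_≡ i) x y → Joins (ends G i) a b →
    a ≢ c × b ≢ c × ¬ Reach G (_≡ c) (_≡ i) a b
  separator-ends {x} {y} (_ , bic) c∈ x∈ y∈ x≢c y≢c ¬r ab =
    (λ { refl → blocked λ nu nv j → ⊥-elim (avoid j nu nv (Joins-unique ab j)) }) ,
    (λ { refl → blocked λ nu nv j → ⊥-elim (avoid′ j nu nv (Joins-unique ab j)) }) ,
    λ r → blocked λ _ _ j → connect r (Joins-unique ab j)
    where
    blocked : ¬ (∀ {u v} → u ≢ c → v ≢ c → Joins (ends G i) u v → Reach G (_≡ c) (_≡ i) u v)
    blocked detour = ¬r (reroute detour (bic x y c x∈ y∈ c∈ (λ { refl → ¬r ε }) x≢c y≢c))
    avoid : ∀ {u v b} → Joins (ends G i) u v → u ≢ c → v ≢ c → (c ≡ u × b ≡ v) ⊎ (c ≡ v × b ≡ u) → ⊥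
    avoid j nu nv (inj₁ (e , _)) = nu (sym e)
    avoid j nu nv (inj₂ (e , _)) = nv (sym e)
    avoid′ : ∀ {u v a} → Joins (ends G i) u v → u ≢ c → v ≢ c → (a ≡ u × c ≡ v) ⊎ (a ≡ v × c ≡ u) → ⊥
    avoid′ j nu nv (inj₁ (_ , e)) = nv (sym e)
    avoid′ j nu nv (inj₂ (_ , e)) = nu (sym e)
    connect : ∀ {u v a b} → Reach G (_≡ c) (_≡ i) a b → (a ≡ u × b ≡ v) ⊎ (a ≡ v × b ≡ u) → Reach G (_≡ c) (_≡ i) u v
    connect r (inj₁ (refl , refl)) = r
    connect r (inj₂ (refl , refl)) = Reach-sym {G = G} r

∈-nonempty : ∀ {A : Set} {x : A} {xs} → x ∈ xs → 1 ≤ length xs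
∈-nonempty (here _)  = s≤s z≤n
∈-nonempty (there _) = s≤s z≤n

module SplitParts {G G₁ G₂ : MG Label} {k c a b : ℕ} {i : EdgeIx G} {EA EB : List (Label × Edge)}
  (wf : WF G) (c∈ : c ∈ V G) (ab : Joins (ends G i) a b)
  (ends-facts : a ≢ c × b ≢ c × ¬ Reach G (_≡ c) (_≡ i) a b)
  (perm : E G ↭ lookup (E G) i ∷ (EA ++ EB))
  (inA : All (BothIn (SideOf G c i a)) EA) (inB : All (BothIn (SideOf G c i b)) EB)
  (uniq₁ : Unique (V G₁)) (V₁⇒ : ∀ x → x ∈ V G₁ → x ∈ V G × SideOf G c i a x)
  (⇒V₁ : ∀ x → x ∈ V G × SideOf G c i a x → x ∈ V G₁)
  (E₁ : E G₁ ≡ (virt k , (a , c)) ∷ EA)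
  (uniq₂ : Unique (V G₂)) (V₂⇒ : ∀ x → x ∈ V G₂ → x ≡ a ⊎ (x ∈ V G × SideOf G c i b x))
  (⇒V₂ : ∀ x → x ≡ a ⊎ (x ∈ V G × SideOf G c i b x) → x ∈ V G₂)
  (E₂ : E G₂ ≡ lookup (E G) i ∷ (virt k , (a , c)) ∷ EB) where

  private
    e : Edge
    e = ends G i

    a≢c : a ≢ c
    a≢c = proj₁ ends-facts

    ab∈ : a ∈ V G × b ∈ V G
    ab∈ = Both-Joins {P = _∈ V G} (All.lookup (WF⇒Both {G = G} wf) (∈-map⁺ proj₂ (∈-lookup {xs = E G} i))) ab

    meet : ∀ {x} → SideOf G c i a x → SideOf G c i b x → x ≡ c
    meet (inj₁ e)  _        = e
    meet (inj₂ _)  (inj₁ e) = e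
    meet (inj₂ ra) (inj₂ rb) = contradiction (ra ◅◅ Reach-sym {G = G} rb) (proj₂ (proj₂ ends-facts))

    S : Separation a b c e (map proj₂ EA) (map proj₂ EB)
    S = record
      { PA = SideOf G c i a ; PB = SideOf G c i b ; meet = meet
      ; aA = inj₂ ε ; cA = inj₁ refl ; bB = inj₂ ε ; cB = inj₁ refl
      ; a≢c = a≢c ; b≢c = proj₁ (proj₂ ends-facts) ; ab = ab
      ; inA = All.map⁺ (All.map id inA) ; inB = All.map⁺ (All.map id inB) }

    edges↭ : edges G ↭ e ∷ map proj₂ EA ++ map proj₂ EB
    edges↭ = ↭-trans (map⁺ proj₂ perm) (↭-reflexive (cong (e ∷_) (map-++ proj₂ EA EB)))

    V₂⊆ : ∀ {x} → x ∈ V G₂ → x ∈ V G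
    V₂⊆ {x} j with V₂⇒ x j
    ... | inj₁ refl    = proj₁ ab∈
    ... | inj₂ (v , _) = v

    WFEdge : ∀ {L : Set} → List ℕ → L × Edge → Set
    WFEdge V (_ , (x , y)) = x ∈ V × y ∈ V × x ≢ y

    wfE : All (WFEdge (V G)) (lookup (E G) i ∷ EA ++ EB)
    wfE = All-resp-↭ perm (proj₂ (proj₂ wf))

    wfEA : All (WFEdge (V G)) EA
    wfEA = All.++⁻ˡ EA (All.tail wfE)

    wfEB : All (WFEdge (V G)) EB
    wfEB = All.++⁻ʳ EA (All.tail wfE)

    a∈V₁ : a ∈ V G₁
    a∈V₁ = ⇒V₁ a (proj₁ ab∈ , inj₂ ε)

    e∈V₂ : ∀ {e} → a ∈ V G₂ → b ∈ V G₂ → Joins e a b → proj₁ e ∈ V G₂ × proj₂ e ∈ V G₂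
    e∈V₂ p q (inj₁ (refl , refl)) = p , q
    e∈V₂ p q (inj₂ (refl , refl)) = q , p

  split-WF : WF G₁ × WF G₂
  split-WF =
    (uniq₁ , ∈-nonempty a∈V₁ , subst (All _) (sym E₁)
      ((a∈V₁ , ⇒V₁ c (c∈ , inj₁ refl) , a≢c) ∷
       All.zipWith (λ ((p , q , n) , (p′ , q′)) → ⇒V₁ _ (p , p′) , ⇒V₁ _ (q , q′) , n) (wfEA , inA))) ,
    (uniq₂ , ∈-nonempty a∈V₂ , subst (All _) (sym E₂)
      ((proj₁ ab₂ , proj₂ ab₂ , proj₂ (proj₂ (All.head wfE))) ∷
       (a∈V₂ , ⇒V₂ c (inj₂ (c∈ , inj₁ refl)) , a≢c) ∷
       All.zipWith (λ ((p , q , n) , (p′ , q′)) → ⇒V₂ _ (inj₂ (p , p′)) , ⇒V₂ _ (inj₂ (q , q′)) , n) (wfEB , inB)))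
    where
    a∈V₂ : a ∈ V G₂
    a∈V₂ = ⇒V₂ a (inj₁ refl)
    ab₂ : proj₁ e ∈ V G₂ × proj₂ e ∈ V G₂
    ab₂ = e∈V₂ a∈V₂ (⇒V₂ b (inj₂ (proj₂ ab∈ , inj₂ ε))) ab

  split-Good : Good G₁ → Good G₂ → Good G
  split-Good h₁ h₂ = HajosL-↭ (↭-sym edges↭) (HajosL-split S count
    (subst (HajosL _) (cong (map proj₂) E₁) h₁) (subst (HajosL _) (cong (map proj₂) E₂) h₂))
    where
    shared : ∀ {x} → x ∈ V G₁ → x ∈ V G₂ → x ∈ c ∷ a ∷ []
    shared {x} p q with V₂⇒ x q
    ... | inj₁ refl    = there (here refl)
    ... | inj₂ (_ , s) = here (meet (proj₂ (V₁⇒ x p)) s)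
    count : length (V G₁) + length (V G₂) ≤ length (V G) + 2
    count = overlap-length uniq₁ uniq₂ (λ p → proj₁ (V₁⇒ _ p)) V₂⊆ shared

  split-sound : (WF G₁ × WF G₂) × (Good G₁ → Good G₂ → Good G)
  split-sound = split-WF , split-Good

Split-sound : ∀ {G k G₁ G₂} → WF G → Split G k G₁ G₂ → (WF G₁ × WF G₂) × (Good G₁ → Good G₂ → Good G)
Split-sound {G₁ = G₁} {G₂} wf split =
  let (c , i , a , b , (bic , _ , c∈ , x , y , x∈ , y∈ , x≢c , y≢c , ¬r) , ab , EA , EB , perm , inA , inB , _ ,
        uniq₁ , V₁⇒ , ⇒V₁ , E₁ , uniq₂ , V₂⇒ , ⇒V₂ , E₂) = split
  in SplitParts.split-sound {G₁ = G₁} {G₂} wf c∈ ab (separator-ends bic c∈ x∈ y∈ x≢c y≢c ¬r ab)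
       perm inA inB uniq₁ V₁⇒ ⇒V₁ E₁ uniq₂ V₂⇒ ⇒V₂ E₂

-- Well-formedness travels forward along the splits and `Good` travels back, which is why the claim
-- for the final list is a function of its well-formedness.
SplitSteps-Good : ∀ {S S′} → Star SplitStep S S′ → All WF S → (All WF S′ → All Good S′) → All Good S
SplitSteps-Good ε wfs h = h wfs
SplitSteps-Good ((G , rest , k , G₁ , G₂ , p , _ , split , refl) ◅ steps) wfs h =
  All-resp-↭ (↭-sym p) (proj₂ sound (All.head goods) (All.head (All.tail goods)) ∷ All.tail (All.tail goods))
  where
  wfs′ : All WF (G ∷ rest)
  wfs′ = All-resp-↭ p wfs
  sound : (WF G₁ × WF G₂) × (Good G₁ → Good G₂ → Good G)
  sound = Split-sound {G} {k} {G₁} {G₂} (All.head wfs′) split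
  goods : All Good (G₁ ∷ G₂ ∷ rest)
  goods = SplitSteps-Good steps (proj₁ (proj₁ sound) ∷ proj₂ (proj₁ sound) ∷ All.tail wfs′) h

-- Triangles satisfy Hajós' conjecture anyway, so only the components in O matter
-- and the merging phase can be ignored.
components-Good : ∀ {G F} → WF G → TwoFiveComponents G F → All SatisfiesHajos F → Good (asLabelled G)
components-Good {G} wf (S , P , O , P′ , (steps , _) , p , tri , _ , _ , _ , refl) h =
  All.head (SplitSteps-Good steps (wf′ ∷ []) λ wfs →
    All-resp-↭ (↭-sym p) (All.++⁺
      (All.zipWith (λ (w , t) → Triangle⇒Good w t) (All.++⁻ˡ P (All-resp-↭ p wfs) , tri))
      (All.map (λ {H} → SatisfiesHajos⇒HajosL {G = H}) (All.++⁻ʳ P′ h))))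
  where
  wf′ : WF (asLabelled G)
  wf′ = proj₁ wf , proj₁ (proj₂ wf) , All.map⁺ (proj₂ (proj₂ wf))

components⇒Hajos : ∀ {G F} → WF G → TwoFiveComponents G F → All SatisfiesHajos F → SatisfiesHajos G
components⇒Hajos {G} wf comps h = HajosL⇒SatisfiesHajos {G = G} wf
  (subst (HajosL _) (sym (map-∘ (E G))) (components-Good {G} wf comps h))

-- Components by union-find

relabel : ℕ → ℕ → ℕ → ℕ
relabel p q x with x ≟ p
... | yes _ = q
... | no  _ = x

-- A representative of the component of `x`, making reachability a decidable equality of numbers:
-- each edge merges the class of one end into that of the other.
component : List Edge → ℕ → ℕ
component []             x = x
component ((p , q) ∷ es) x = relabel (component es p) (component es q) (component es x)

relabel-≡ : ∀ p q → relabel p q p ≡ relabel p q q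
relabel-≡ p q with p ≟ p | q ≟ p
... | yes _ | yes _ = refl
... | yes _ | no _  = refl
... | no n  | _     = contradiction refl n

component-edge : ∀ es {f u v} → f ∈ es → Joins f u v → component es u ≡ component es v
component-edge ((p , q) ∷ es) (here refl) (inj₁ (refl , refl)) = relabel-≡ (component es p) (component es q)
component-edge ((p , q) ∷ es) (here refl) (inj₂ (refl , refl)) = sym (relabel-≡ (component es p) (component es q))
component-edge (_ ∷ es)       (there i)   j                    = cong (relabel _ _) (component-edge es i j)

Walk : List Edge → ℕ → ℕ → Set
Walk es = Star (λ u v → ∃ λ f → f ∈ es × Joins f u v)

Walk-weaken : ∀ {f es x y} → Walk es x y → Walk (f ∷ es) x y
Walk-weaken = Star.map λ (g , i , j) → g , there i , j

component-Walk : ∀ es {x y} → component es x ≡ component es y → Walk es x y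
component-Walk [] refl = ε
component-Walk ((p , q) ∷ es) {x} {y} e with component es x ≟ component es p | component es y ≟ component es p
... | yes i | yes j = Walk-weaken (component-Walk es (trans i (sym j)))
... | no _  | no _  = Walk-weaken (component-Walk es e)
... | yes i | no _  =
  Walk-weaken (component-Walk es i) ◅◅ ((p , q) , here refl , inj₁ (refl , refl)) ◅ Walk-weaken (component-Walk es e)
... | no _  | yes j =
  Walk-weaken (component-Walk es e) ◅◅ ((p , q) , here refl , inj₂ (refl , refl)) ◅ Walk-weaken (component-Walk es (sym j))

Avoids : ℕ → Edge → Set
Avoids c = Both (_≢ c)

avoids? : ∀ c → Decidable (Avoids c)
avoids? c (x , y) = ¬? (x ≟ c) ×-dec ¬? (y ≟ c)

componentWithout : ℕ → List Edge → ℕ → ℕ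
componentWithout c es = component (filter (avoids? c) es)

componentWithout-edge : ∀ c es {f u v} → f ∈ es → u ≢ c → v ≢ c → Joins f u v →
  componentWithout c es u ≡ componentWithout c es v
componentWithout-edge c es {f} i nu nv j = component-edge _ (∈-filter⁺ (avoids? c) i (avoids j)) j
  where
  avoids : Joins f _ _ → Avoids c f
  avoids (inj₁ (refl , refl)) = nu , nv
  avoids (inj₂ (refl , refl)) = nv , nu

-- `P` and `Q` stay general so that one lemma yields connectedness (`c` outside the graph),
-- biconnectedness (`P` forbids `c`) and reachability past a vertex and an edge.
Walk⇒Reach : ∀ {L} {G : MG L} {P : ℕ → Set} {Q c} es → (∀ {x} → x ≢ c → ¬ P x) →
  (∀ {f} → f ∈ es → ∃ λ j → ¬ Q j × ends G j ≡ f) →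
  ∀ {x y} → componentWithout c es x ≡ componentWithout c es y → Reach G P Q x y
Walk⇒Reach {c = c} es avoidP index e = Star.map toStep (component-Walk (filter (avoids? c) es) e)
  where
  toStep : ∀ {u v} → (∃ λ f → f ∈ filter (avoids? c) es × Joins f u v) → Step _ _ _ u v
  toStep (f , i , j) with i′ , av ← ∈-filter⁻ (avoids? c) {xs = es} i with k , nq , refl ← index i′ =
    step k nq (avoidP (proj₁ (Both-Joins {P = _≢ c} av j))) (avoidP (proj₂ (Both-Joins {P = _≢ c} av j))) j

-- Cutting a list of edges along the component of u in the graph without c
module Side (c u : ℕ) (es : List Edge) where

  private
    κ : ℕ → ℕ
    κ = componentWithout c es

  Inner : ℕ → Set
  Inner x = x ≢ c × κ x ≡ κ u

  inner? : Decidable Inner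
  inner? x = ¬? (x ≟ c) ×-dec (κ x ≟ κ u)

  -- `Far` collects `c` and every component other than that of `u`, so nothing is assumed about the
  -- number of components.
  Near Far : ℕ → Set
  Near x = x ≡ c ⊎ Inner x
  Far x = ¬ Inner x

  near? : Decidable Near
  near? x = (x ≟ c) ⊎-dec inner? x

  far? : Decidable Far
  far? x = ¬? (inner? x)

  Near∩Far : ∀ {x} → Near x → Far x → x ≡ c
  Near∩Far (inj₁ e) _ = e
  Near∩Far (inj₂ p) n = contradiction p n

  touches? : Decidable (λ ((p , q) : Edge) → Inner p ⊎ Inner q)
  touches? (p , q) = inner? p ⊎-dec inner? q

  nearEdges farEdges : List Edge
  nearEdges = filter touches? es
  farEdges  = filter (¬? ∘ touches?) es

  near++far : es ↭ nearEdges ++ farEdges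
  near++far = filter-split touches? es

  other-end : ∀ {f p q} → f ∈ es → Joins f p q → Inner p → Near q
  other-end {q = q} i j (np , e) with q ≟ c
  ... | yes eq = inj₁ eq
  ... | no nq  = inj₂ (nq , trans (sym (componentWithout-edge c es i np nq j)) e)

  inNear : All (Both Near) nearEdges
  inNear = All.tabulate λ i → let i′ , t = ∈-filter⁻ touches? {xs = es} i in
    [ (λ p → inj₂ p , other-end i′ (inj₁ (refl , refl)) p)
    , (λ q → other-end i′ (inj₂ (refl , refl)) q , inj₂ q) ]′ t

  inFar : All (Both Far) farEdges
  inFar = All.map (λ n → n ∘ inj₁ , n ∘ inj₂) (All.all-filter (¬? ∘ touches?) es)

-- Finite search and lists with one entry removed

search : ∀ {A : Set} {P Q : A → Set} → (∀ x → P x ⊎ Q x) → ∀ xs →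
  (∀ {x} → x ∈ xs → P x) ⊎ ∃ λ x → x ∈ xs × Q x
search t [] = inj₁ λ ()
search t (x ∷ xs) with t x | search t xs
... | inj₂ q | _                = inj₂ (x , here refl , q)
... | inj₁ _ | inj₂ (y , i , q) = inj₂ (y , there i , q)
... | inj₁ p | inj₁ h           = inj₁ λ { (here refl) → p ; (there i) → h i }

agree? : ∀ (κ : ℕ → ℕ) c xs →
  (∀ {x y} → x ∈ xs → y ∈ xs → x ≢ c → y ≢ c → κ x ≡ κ y) ⊎
  (∃₂ λ x y → x ∈ xs × y ∈ xs × x ≢ c × y ≢ c × κ x ≢ κ y)
agree? κ c xs with search (λ x → search {Q = λ y → κ x ≢ κ y} (λ y → test (κ x ≟ κ y)) W) W
  where
  test : ∀ {A : Set} → Dec A → A ⊎ ¬ A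
  test (yes p) = inj₁ p
  test (no n)  = inj₂ n
  W : List ℕ
  W = filter (λ x → ¬? (x ≟ c)) xs
... | inj₁ h = inj₁ λ i j n m → h (∈-filter⁺ (λ x → ¬? (x ≟ c)) i n) (∈-filter⁺ (λ x → ¬? (x ≟ c)) j m)
... | inj₂ (x , i , y , j , n) =
  let i′ , nx = ∈-filter⁻ (λ x → ¬? (x ≟ c)) {xs = xs} i
      j′ , ny = ∈-filter⁻ (λ x → ¬? (x ≟ c)) {xs = xs} j
  in inj₂ (x , y , i′ , j′ , nx , ny , n)

removeAt-↭ : ∀ {A : Set} (xs : List A) i → xs ↭ lookup xs i ∷ removeAt xs i
removeAt-↭ (x ∷ xs) zero    = refl
removeAt-↭ (x ∷ xs) (suc i) = ↭-trans (prep x (removeAt-↭ xs i)) (_↭_.swap x _ refl)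

∈-index : ∀ {A : Set} {x : A} {xs} → x ∈ xs → ∃ λ j → lookup xs j ≡ x
∈-index i = Any.index i , sym (lookup-index i)

∈-removeAt⁻ : ∀ {A : Set} {x : A} xs i → x ∈ removeAt xs i → ∃ λ j → j ≢ i × lookup xs j ≡ x
∈-removeAt⁻ (y ∷ ys) zero k with j , e ← ∈-index k = suc j , (λ ()) , e
∈-removeAt⁻ (y ∷ ys) (suc i) (here refl) = zero , (λ ()) , refl
∈-removeAt⁻ (y ∷ ys) (suc i) (there k) with j , n , e ← ∈-removeAt⁻ ys i k = suc j , n ∘ Fin.suc-injective , e

∈-removeAt⁺ : ∀ {A : Set} (xs : List A) {i j} → j ≢ i → lookup xs j ∈ removeAt xs i
∈-removeAt⁺ (y ∷ ys) {zero}  {zero}  n = contradiction refl n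
∈-removeAt⁺ (y ∷ ys) {zero}  {suc j} n = ∈-lookup {xs = ys} j
∈-removeAt⁺ (y ∷ ys) {suc i} {zero}  n = here refl
∈-removeAt⁺ (y ∷ ys) {suc i} {suc j} n = there (∈-removeAt⁺ ys (n ∘ cong suc))

∈⇒≤sum : ∀ {x xs} → x ∈ xs → x ≤ sum xs
∈⇒≤sum {xs = x ∷ xs} (here refl) = m≤m+n x (sum xs)
∈⇒≤sum {xs = y ∷ xs} (there i)   = ≤-trans (∈⇒≤sum i) (m≤n+m (sum xs) y)

-- Induction on |V| + |E|

WFL : List ℕ → List Edge → Set
WFL V E = Unique V × 1 ≤ length V × All (λ (x , y) → x ∈ V × y ∈ V × x ≢ y) E

WFL-resp-↭ : ∀ {V E F} → E ↭ F → WFL V E → WFL V F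
WFL-resp-↭ p (u , l , ok) = u , l , All-resp-↭ p ok

HajosBelow : ℕ → Set
HajosBelow m = ∀ V E → length V + length E < m → WFL V E → HajosL (length V) E

-- For `c` in `V` this is the cut-vertex case, for `c` outside `V` the disconnected case. Both parts
-- are smaller: the near part loses `v`, the far part loses `u`.
HajosL-cut : ∀ {V E c u v} → WFL V E → u ∈ V → v ∈ V → u ≢ c → v ≢ c →
  componentWithout c E u ≢ componentWithout c E v → HajosBelow (length V + length E) → HajosL (length V) E
HajosL-cut {V} {E} {c} {u} {v} (uniq , _ , ok) u∈ v∈ u≢c v≢c u≁v ih =
  HajosL-↭ (↭-sym near++far) (HajosL-glue Near∩Far inNear inFar
    (overlap-length {ws = [ c ]} (Unique.filter⁺ near? uniq) (Unique.filter⁺ far? uniq)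
      (proj₁ ∘ ∈-filter⁻ near? {xs = V}) (proj₁ ∘ ∈-filter⁻ far? {xs = V})
      (λ i j → here (Near∩Far (proj₂ (∈-filter⁻ near? {xs = V} i)) (proj₂ (∈-filter⁻ far? {xs = V} j)))))
    (ih V₁ nearEdges
      (+-mono-<-≤ (filter-notAll near? V (lose v∈ v-far)) (length-filter touches? E))
      (Unique.filter⁺ near? uniq , ∈-nonempty (∈-filter⁺ near? u∈ (inj₂ (u≢c , refl))) ,
       All.zipWith (λ ((p , q , n) , (p′ , q′)) → ∈-filter⁺ near? p p′ , ∈-filter⁺ near? q q′ , n)
         (All.filter⁺ touches? ok , inNear)))
    (ih V₂ farEdges
      (+-mono-<-≤ (filter-notAll far? V (lose u∈ λ n → n (u≢c , refl))) (length-filter (¬? ∘ touches?) E))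
      (Unique.filter⁺ far? uniq , ∈-nonempty (∈-filter⁺ far? v∈ (v-far ∘ inj₂)) ,
       All.zipWith (λ ((p , q , n) , (p′ , q′)) → ∈-filter⁺ far? p p′ , ∈-filter⁺ far? q q′ , n)
         (All.filter⁺ (¬? ∘ touches?) ok , inFar))))
  where
  open Side c u E
  V₁ V₂ : List ℕ
  V₁ = filter near? V
  V₂ = filter far? V
  v-far : ¬ Near v
  v-far (inj₁ e)       = v≢c e
  v-far (inj₂ (_ , e)) = u≁v (sym e)

-- The measure drops in both parts. The part of `a` loses the vertex `b` and has no more edges than
-- before. The part of `b` may keep all vertices, but trades `e` and `EA` for two edges, which is
-- progress exactly because `EA` has at least two.
HajosL-reduce : ∀ {V a b c e EA EB} (S : Separation a b c e EA EB) →
  Decidable (Separation.PA S) → Decidable (Separation.PB S) →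
  WFL V (e ∷ EA ++ EB) → a ∈ V → b ∈ V → c ∈ V → 2 ≤ length EA →
  HajosBelow (length V + length (e ∷ EA ++ EB)) → HajosL (length V) (e ∷ EA ++ EB)
HajosL-reduce {V} {a} {b} {c} {e} {EA} {EB} S PA? PB? (uniq , _ , (e₁ , e₂ , e≢) ∷ ok) a∈ b∈ c∈ long ih =
  HajosL-split S count
    (ih V₁ ((a , c) ∷ EA) (+-mono-<-≤ (filter-notAll PA? V (lose b∈ ¬bA)) (s≤s A≤))
      (uniq₁ , ∈-nonempty a∈₁ , (a∈₁ , ∈-filter⁺ PA? c∈ cA , a≢c) ∷
       All.zipWith (λ ((p , q , n) , (p′ , q′)) → ∈-filter⁺ PA? p p′ , ∈-filter⁺ PA? q q′ , n) (All.++⁻ˡ EA ok , inA)))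
    (ih (a ∷ V₂) (e ∷ (a , c) ∷ EB) (+-mono-≤-< (filter-notAll PB? V (lose a∈ ¬aB)) (s≤s B<))
      (uniq₂ , s≤s z≤n , (proj₁ (e∈ ab) , proj₂ (e∈ ab) , e≢) ∷ (here refl , there (∈-filter⁺ PB? c∈ cB) , a≢c) ∷
       All.zipWith (λ ((p , q , n) , (p′ , q′)) → there (∈-filter⁺ PB? p p′) , there (∈-filter⁺ PB? q q′) , n) (All.++⁻ʳ EA ok , inB)))
  where
  open Separation S
  ¬bA : ¬ PA b
  ¬bA = Separation.¬aB (Separation-sym S)
  V₁ V₂ : List ℕ
  V₁ = filter PA? V
  V₂ = filter PB? V
  uniq₁ : Unique V₁
  uniq₁ = Unique.filter⁺ PA? uniq
  uniq₂ : Unique (a ∷ V₂)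
  uniq₂ = All.map (λ q → λ { refl → ¬aB q }) (All.all-filter PB? V) ∷ Unique.filter⁺ PB? uniq
  a∈₁ : a ∈ V₁
  a∈₁ = ∈-filter⁺ PA? a∈ aA
  e∈ : Joins e a b → proj₁ e ∈ a ∷ V₂ × proj₂ e ∈ a ∷ V₂
  e∈ (inj₁ (refl , refl)) = here refl , there (∈-filter⁺ PB? b∈ bB)
  e∈ (inj₂ (refl , refl)) = there (∈-filter⁺ PB? b∈ bB) , here refl
  count : length V₁ + length (a ∷ V₂) ≤ length V + 2
  count = overlap-length {ws = c ∷ a ∷ []} uniq₁ uniq₂ (proj₁ ∘ ∈-filter⁻ PA? {xs = V})
    (λ { (here refl) → a∈ ; (there i) → proj₁ (∈-filter⁻ PB? {xs = V} i) })
    (λ { _ (here refl) → there (here refl)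
       ; i (there j) → here (meet (proj₂ (∈-filter⁻ PA? {xs = V} i)) (proj₂ (∈-filter⁻ PB? {xs = V} j))) })
  A≤ : length EA ≤ length (EA ++ EB)
  A≤ = subst (length EA ≤_) (sym (length-++ EA)) (m≤m+n _ _)
  B< : 2 + length EB ≤ length (EA ++ EB)
  B< = subst (2 + length EB ≤_) (sym (length-++ EA)) (+-monoˡ-≤ (length EB) long)

2∤1 : ¬ 2 ∣ 1
2∤1 d = contradiction (∣⇒≤ d) λ { (s≤s ()) }

-- With the virtual edge ac alone, `a` and `c` would have degree 1. A single further edge must
-- therefore meet both of them.
AllEven-short : ∀ {a c es} → a ≢ c → All (λ (x , y) → x ≢ y) es → length es < 2 →
  AllEven ((a , c) ∷ es) → ∃ λ f → es ≡ [ f ] × Joins f a c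
AllEven-short {a} {c} {[]} a≢c _ _ ev =
  contradiction (subst (2 ∣_) (cong₂ (λ m n → m + n + 0) (ind-≡ a) (ind-≢ (≢-sym a≢c))) (ev a)) 2∤1
AllEven-short {a} {c} {(p , q) ∷ []} a≢c (p≢q ∷ []) _ ev = (p , q) , refl ,
  match (hit a (cong₂ _+_ (ind-≡ a) (ind-≢ (≢-sym a≢c)))) (hit c (cong₂ _+_ (ind-≢ a≢c) (ind-≡ c)))
  where
  hit : ∀ x → inc x (a , c) ≡ 1 → p ≡ x ⊎ q ≡ x
  hit x e with p ≟ x | q ≟ x
  ... | yes i | _     = inj₁ i
  ... | no _  | yes j = inj₂ j
  ... | no np | no nq = contradiction
    (subst (2 ∣_) (cong₂ (λ i j → i + (j + 0)) e (cong₂ _+_ (ind-≢ np) (ind-≢ nq))) (ev x)) 2∤1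
  match : p ≡ a ⊎ q ≡ a → p ≡ c ⊎ q ≡ c → Joins (p , q) a c
  match (inj₁ i) (inj₁ j) = contradiction (trans (sym i) j) a≢c
  match (inj₁ i) (inj₂ j) = inj₁ (i , j)
  match (inj₂ i) (inj₁ j) = inj₂ (j , i)
  match (inj₂ i) (inj₂ j) = contradiction (trans (sym i) j) a≢c
AllEven-short {es = _ ∷ _ ∷ _} _ _ (s≤s (s≤s ())) _

HajosL-small : ∀ {V a b c e EA EB} → Separation a b c e EA EB → WFL V (e ∷ EA ++ EB) →
  a ∈ V → b ∈ V → c ∈ V → length EA < 2 → length EB < 2 → HajosL (length V) (e ∷ EA ++ EB)
HajosL-small {V} {a} {b} {c} {e} {EA} {EB} S (_ , _ , _ ∷ ok) a∈ b∈ c∈ shortA shortB ev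
  with f , refl , jf ← AllEven-short (Separation.a≢c S) (All.map (proj₂ ∘ proj₂) (All.++⁻ˡ EA ok)) shortA (AllEven-sideA S ev)
  with g , refl , jg ← AllEven-short (Separation.b≢c S) (All.map (proj₂ ∘ proj₂) (All.++⁻ʳ EA ok)) shortB (AllEven-sideB S ev) =
  HajosL-↭ (prep e (_↭_.swap g f refl)) (HajosL-triangle ab jg (Joins-swap jf) a≢b b≢c (≢-sym a≢c)
    (Unique-⊆-length ((a≢b ∷ a≢c ∷ []) ∷ (b≢c ∷ []) ∷ [] ∷ [])
      (λ { (here refl) → a∈ ; (there (here refl)) → b∈ ; (there (there (here refl))) → c∈ }))) ev
  where open Separation S

HajosL-separation : ∀ {V a b c e EA EB} (S : Separation a b c e EA EB) →
  Decidable (Separation.PA S) → Decidable (Separation.PB S) →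
  WFL V (e ∷ EA ++ EB) → a ∈ V → b ∈ V → c ∈ V →
  HajosBelow (length V + length (e ∷ EA ++ EB)) → HajosL (length V) (e ∷ EA ++ EB)
HajosL-separation {V} {e = e} {EA} {EB} S PA? PB? wf a∈ b∈ c∈ ih with 2 ≤? length EA | 2 ≤? length EB
... | yes l | _     = HajosL-reduce S PA? PB? wf a∈ b∈ c∈ l ih
... | no s  | no t  = HajosL-small S wf a∈ b∈ c∈ (≰⇒> s) (≰⇒> t)
... | no _  | yes l =
  HajosL-↭ (↭-sym p) (HajosL-reduce (Separation-sym S) PB? PA? (WFL-resp-↭ p wf) b∈ a∈ c∈ l
    (subst (λ k → HajosBelow (length V + k)) (↭-length p) ih))
  where
  p : e ∷ EA ++ EB ↭ e ∷ EB ++ EA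
  p = prep e (++-comm EA EB)

-- From 2.5-connected graphs to all graphs

plain : List ℕ → List Edge → MG ⊤
plain V E = mkMG V (map (tt ,_) E)

edges-plain : ∀ V E → edges (plain V E) ≡ E
edges-plain V E = trans (sym (map-∘ E)) (map-id E)

module _ (hajos : (G : MG ⊤) → WF G → TwoFiveConnected G → SatisfiesHajos G) where

  private
    module InductionStep (G : MG ⊤) (wf : WF G) (ih : HajosBelow (length (V G) + length (edges G))) where

      wfl : WFL (V G) (edges G)
      wfl = proj₁ wf , proj₁ (proj₂ wf) , All.map⁺ (proj₂ (proj₂ wf))

      -- not a vertex, so that w = fresh tests connectivity
      fresh : ℕ
      fresh = suc (sum (V G))

      ≢fresh : ∀ {x} → x ∈ V G → x ≢ fresh
      ≢fresh i refl = 1+n≰n (∈⇒≤sum i)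

      edge-index : ∀ {f} → f ∈ edges G → ∃ λ j → ¬ ⊥ × ends G j ≡ f
      edge-index i with (_ , f) , k , refl ← ∈-map⁻ proj₂ i with j , e ← ∈-index k = j , id , cong proj₂ e

      rest : EdgeIx G → List Edge
      rest i = map proj₂ (removeAt (E G) i)

      rest-index : ∀ i {f} → f ∈ rest i → ∃ λ j → j ≢ i × ends G j ≡ f
      rest-index i m with (_ , f) , k , refl ← ∈-map⁻ proj₂ m with j , n , e ← ∈-removeAt⁻ (E G) i k = j , n , cong proj₂ e

      Reach-component : ∀ {c i x y} → Reach G (_≡ c) (_≡ i) x y → componentWithout c (rest i) x ≡ componentWithout c (rest i) y
      Reach-component ε = refl
      Reach-component {c} {i} (step j n nx ny jn ◅ r) =
        trans (componentWithout-edge c (rest i) (∈-map⁺ proj₂ (∈-removeAt⁺ (E G) n)) nx ny jn) (Reach-component r)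

      component-Reach : ∀ {c i x y} → componentWithout c (rest i) x ≡ componentWithout c (rest i) y → Reach G (_≡ c) (_≡ i) x y
      component-Reach {c} {i} = Walk⇒Reach (rest i) id (rest-index i)

      good-separable : ∀ {c i x y} → Biconnected G → c ∈ V G → x ∈ V G → y ∈ V G → x ≢ c → y ≢ c →
        componentWithout c (rest i) x ≢ componentWithout c (rest i) y → Good G
      good-separable {c} {i} bic c∈ x∈ y∈ x≢c y≢c x≁y =
        HajosL-↭ (↭-sym p) (HajosL-separation S near? far? (WFL-resp-↭ p wfl) a∈ b∈ c∈
          (subst (λ k → HajosBelow (length (V G) + k)) (↭-length p) ih))
        where
        a b : ℕ
        a = proj₁ (ends G i)
        b = proj₂ (ends G i)
        facts : a ≢ c × b ≢ c × ¬ Reach G (_≡ c) (_≡ i) a b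
        facts = separator-ends bic c∈ x∈ y∈ x≢c y≢c (x≁y ∘ Reach-component) (inj₁ (refl , refl))
        open Side c a (rest i)
        p : edges G ↭ (a , b) ∷ nearEdges ++ farEdges
        p = ↭-trans (map⁺ proj₂ (removeAt-↭ (E G) i)) (prep (a , b) near++far)
        S : Separation a b c (a , b) nearEdges farEdges
        S = record
          { PA = Near ; PB = Far ; meet = Near∩Far
          ; aA = inj₂ (proj₁ facts , refl) ; cA = inj₁ refl
          ; bB = λ (_ , e) → proj₂ (proj₂ facts) (component-Reach (sym e)) ; cB = λ (n , _) → n refl
          ; a≢c = proj₁ facts ; b≢c = proj₁ (proj₂ facts) ; ab = inj₁ (refl , refl)
          ; inA = inNear ; inB = inFar }
        ab∈ : Both (_∈ V G) (ends G i)
        ab∈ = All.lookup (WF⇒Both {G = G} wf) (∈-map⁺ proj₂ (∈-lookup {xs = E G} i))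
        a∈ : a ∈ V G
        a∈ = proj₁ ab∈
        b∈ : b ∈ V G
        b∈ = proj₂ ab∈

      good-biconnected : Biconnected G → Good G
      good-biconnected bic
        with search (λ c → search (λ i → agree? (componentWithout c (rest i)) c (V G)) (allFin (length (E G)))) (V G)
      -- The search ignores the exemption of triangles in `VESeparator`. A triangle is found here,
      -- by a vertex and its opposite edge, and ends up in `HajosL-small`.
      ... | inj₂ (c , c∈ , i , _ , x , y , x∈ , y∈ , x≢c , y≢c , x≁y) = good-separable bic c∈ x∈ y∈ x≢c y≢c x≁y
      ... | inj₁ h = SatisfiesHajos⇒HajosL {G = G} (hajos G wf
        (bic , λ c i (_ , _ , c∈ , x , y , x∈ , y∈ , x≢c , y≢c , ¬r) →
          ¬r (component-Reach (h c∈ (∈-allFin i) x∈ y∈ x≢c y≢c))))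

      good : Good G
      -- No vertex is deleted for `w = fresh`, so agreement there means connectedness; agreement for
      -- each `w` in `V G` means that there is no cut vertex.
      good with search (λ w → agree? (componentWithout w (edges G)) w (V G)) (fresh ∷ V G)
      ... | inj₂ (w , _ , x , y , x∈ , y∈ , x≢w , y≢w , x≁y) = HajosL-cut wfl x∈ y∈ x≢w y≢w x≁y ih
      ... | inj₁ h = good-biconnected
        ( (λ x y x∈ y∈ → Walk⇒Reach (edges G) (λ _ ()) edge-index (h (here refl) x∈ y∈ (≢fresh x∈) (≢fresh y∈)))
        , (λ u v w u∈ v∈ w∈ u≢v u≢w v≢w → Walk⇒Reach (edges G) id edge-index (h (there w∈) u∈ v∈ u≢w v≢w)))

    below : ∀ m → HajosBelow m
    below zero    _ _ ()
    below (suc m) V E (s≤s l) (u , n , ok) = subst (HajosL (length V)) (edges-plain V E)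
      (InductionStep.good (plain V E) (u , n , All.map⁺ ok)
        λ V′ E′ l′ → below m V′ E′ (≤-trans l′ (subst (λ F → length V + length F ≤ m) (sym (edges-plain V E)) l)))

  2·5-connected⇒Hajos : (G : MG ⊤) → WF G → SatisfiesHajos G
  2·5-connected⇒Hajos G wf = HajosL⇒SatisfiesHajos {G = G} wf (InductionStep.good G wf (below _))

theorem11 :
    ((G : MG ⊤) → WF G → Biconnected G →
      (F : List (MG Label)) → TwoFiveComponents G F → All SatisfiesHajos F →
      SatisfiesHajos G)
    ×
    ((((G : MG ⊤) → WF G → SatisfiesHajos G) →
        ((G : MG ⊤) → WF G → TwoFiveConnected G → SatisfiesHajos G))
     ×
     (((G : MG ⊤) → WF G → TwoFiveConnected G → SatisfiesHajos G) →
        ((G : MG ⊤) → WF G → SatisfiesHajos G)))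
theorem11 =
  (λ G wf _ F → components⇒Hajos wf) , (λ hajos G wf _ → hajos G wf) , 2·5-connected⇒Hajos
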